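{- Let the hypergraphs $\mathsf H_{20}$, $\mathsf H_{21}$, the complex vectors $\psi^{(20)}_v\in\mathbb C^3$ ($v$ a vertex of $\mathsf H_{20}$), $\psi^{(21)}_v\in\mathbb C^3$ ($v$ a vertex of $\mathsf H_{21}$), and the maps $\Phi_t:\mathbb C^3\to\mathbb R^6$ ($t\in\mathbb R$) be as defined in the context. (i) Define $$t_v^{(20)}=\begin{cases}1,&v\in\{v_{34},v_{45},v_{56}\},\\ 2,&v\in\{v_{67},v_{70}\},\\ 0,&\text{otherwise}.\end{cases}$$ Then $R_v^{(20)}=\Phi_{t_v^{(20)}}(\psi_v^{(20)})$ is a faithful orthogonal representation of $\mathsf H_{20}$ in $\mathbb R^6$. (ii) Define $$t_v^{(21)}=\begin{cases}1,&v=v_{45},\\ 2,&v\in\{v_2,v_3,v_6,v_7,v_{34},v_{56},v_{70}\},\\ 3,&v=v_{67},\\ 0,&\text{otherwise}.\end{cases}$$ Then $R_v^{(21)}=\Phi_{t_v^{(21)}}(\psi_v^{(21)})$ is a faithful orthogonal representation of $\mathsf H_{21}$ in $\mathbb R^6$.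
   Context: Inner product: $\langle x,y\rangle=\sum_{k}\overline{x_k}\,y_k$ (over $\mathbb R$, the standard dot product). Faithful orthogonal representation: let $\mathsf H=(V,\mathcal E)$ be a three-uniform hypergraph, $\mathbb F\in\{\mathbb R,\mathbb C\}$ and $d\ge 3$. A faithful orthogonal representation of $\mathsf H$ in $\mathbb F^d$ assigns to every $v\in V$ a nonzero vector $x_v\in\mathbb F^d$ such that (1) distinct vertices determine distinct rays (one-dimensional subspaces), and (2) for distinct $u,v\in V$, $\langle x_u,x_v\rangle=0$ if and only if $u$ and $v$ belong to a common hyperedge. The maps $\Phi_t$: for $t\in\mathbb R$ and $z=x+\mathrm iy\in\mathbb C^3$ with $x,y\in\mathbb R^3$, $$\Phi_t(x+\mathrm iy)=\frac{(x-ty,\ y+tx)}{\sqrt{1+t^2}}\in\mathbb R^6 .$$ Equivalently $\Phi_t(z)=\Phi_0(\lambda_t z)$ with $\lambda_t=(1+\mathrm it)/\sqrt{1+t^2}$ and $\Phi_0(z)=(\mathrm{Re}\,z_1,\mathrm{Re}\,z_2,\mathrm{Re}\,z_3,\mathrm{Im}\,z_1,\mathrm{Im}\,z_2,\mathrm{Im}\,z_3)$. The hypergraph $\mathsf H_{20}$: it has 20 vertices, namely $v_0,\ldots,v_7$, $v_{01},v_{12},v_{23},v_{34},v_{45},v_{56},v_{67},v_{70}$ (also written $v_{j,j+1}$ with indices modulo $8$), and $a_1,a_2,b_1,b_2$. Its 12 hyperedges are $E_j=\{v_{j-1,j},\,v_j,\,v_{j,j+1}\}$ for $j=0,\ldots,7$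 (indices modulo $8$), and $D_0=\{v_0,a_1,v_4\}$, $D_2=\{v_2,a_2,v_6\}$, $D_1=\{v_1,b_2,v_5\}$, $D_3=\{v_3,b_1,v_7\}$. The hypergraph $\mathsf H_{21}$ is obtained from $\mathsf H_{20}$ by adding one vertex $c$ and the two hyperedges $F_a=\{a_1,c,a_2\}$, $F_b=\{b_1,c,b_2\}$ (21 vertices, 14 hyperedges). The vectors $\psi^{(20)}_v$ (written with the vertex name): set $C=\frac{49-5\sqrt{69}}{26}$, $s=\sqrt C$, $N=1+C$, $r=\sqrt N$, $\eta=\frac{5+12\mathrm i}{13}$, $\zeta=\frac{14+6\sqrt{69}}{65}+\mathrm i\,\frac{4\sqrt{69}-21}{65}$, $(\mu_0,\ldots,\mu_7)=(-1,\eta,1,-\eta,-1,\eta,1,-\eta)$, $(\tau_0,\ldots,\tau_7)=(1,\zeta,-\mathrm i,-\mathrm i\zeta,-1,-\zeta,\mathrm i,\mathrm i\zeta)$. Then $a_1=(s,1,0)$, $a_2=(s,-1,0)$, $b_1=(s,\eta,0)$, $b_2=(s,-\eta,0)$, $v_j=(1,s\mu_j,r\tau_j)$ for $j=0,\ldots,7$, and for $j$ modulo $8$ $$v_{j,j+1}=\overline{v_j\times v_{j+1}}=\bigl(sr(\bar\mu_j\bar\tau_{j+1}-\bar\tau_j\bar\mu_{j+1}),\ r(\bar\tau_j-\bar\tau_{j+1}),\ s(\bar\mu_{j+1}-\bar\mu_j)\bigr).$$ The vectors $\psi^{(21)}_v$ (written with the vertex name): set $p=\frac{\sqrt{14}+\sqrt2}{4}$,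 $q=\frac{\sqrt{14}-\sqrt2}{4}$. Then $c=(0,0,1)$, $a_1=(1,1,0)$, $a_2=(1,-1,0)$, $b_1=(1,\mathrm i,0)$, $b_2=(1,-\mathrm i,0)$, \begin{align*} v_0&=(1,-1,\sqrt2),& v_4&=(1,-1,-\sqrt2),\\ v_1&=(1,\mathrm i,p+\mathrm iq),& v_5&=(1,\mathrm i,-p-\mathrm iq),\\ v_2&=(1,1,-\mathrm i\sqrt2),& v_6&=(1,1,\mathrm i\sqrt2),\\ v_3&=(1,-\mathrm i,q-\mathrm ip),& v_7&=(1,-\mathrm i,-q+\mathrm ip), \end{align*} \begin{align*} v_{01}&=(-p+\mathrm i(q+\sqrt2),\ \sqrt2-p+\mathrm iq,\ 1-\mathrm i),\\ v_{12}&=(\sqrt2-p+\mathrm iq,\ p-\mathrm i(q+\sqrt2),\ 1+\mathrm i),\\ v_{23}&=(q+\sqrt2+\mathrm ip,\ -q+\mathrm i(\sqrt2-p),\ -1+\mathrm i),\\ v_{34}&=(q+\mathrm i(p-\sqrt2),\ q+\sqrt2+\mathrm ip,\ -1-\mathrm i),\\ v_{45}&=(p-\mathrm i(q+\sqrt2),\ -\sqrt2+p-\mathrm iq,\ 1-\mathrm i),\\ v_{56}&=(-\sqrt2+p-\mathrm iq,\ -p+\mathrm i(q+\sqrt2),\ 1+\mathrm i),\\ v_{67}&=(-q-\sqrt2-\mathrm ip,\ q-\mathrm i(\sqrt2-p),\ -1+\mathrm i),\\ v_{70}&=(-q-\mathrm i(p-\sqrt2),\ -q-\sqrt2-\mathrm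 ip,\ -1-\mathrm i). \end{align*} -}

module Defs where

open import Level using (Level; _⊔_; suc)
open import Function.Base using (_∘_)
open import Algebra.Core using (Op₁)
open import Algebra.Bundles using (RawRing; CommutativeRing)
open import Algebra.Apartness.Bundles using (HeytingField; HeytingCommutativeRing)
import Algebra.Apartness.Properties.HeytingCommutativeRing as HeytingProperties
import Algebra.Definitions.RawMonoid as RawMonoidDefinitions
import Algebra.Properties.Ring as RingProperties
open import Data.Empty using (⊥-elim)
open import Data.Fin using (Fin; toℕ; #_)
open import Data.Fin.Properties using (all?) renaming (_≟_ to _≟ᶠ_)
open import Data.Nat.Base as ℕ using (ℕ; NonZero)
open import Data.Nat.DivMod using (_mod_)
open import Data.Product.Base using (∃; _×_; _,_; proj₁; proj₂)
open import Data.Sum.Base using (_⊎_; inj₁; inj₂)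
open import Data.Vec.Base using (Vec; []; _∷_; map; lookup)
import Data.Vec.Functional as Functional
open Functional using (Vector)
open import Data.Vec.Membership.Propositional using (_∈_)
open import Data.Vec.Relation.Unary.All using ([]; _∷_)
open import Data.Vec.Relation.Unary.AllPairs using ([]; _∷_)
open import Data.Vec.Relation.Unary.Unique.Propositional using (Unique)
open import Data.Vec.Relation.Unary.Unique.Propositional.Properties using (map⁺)
open import Relation.Binary.Core using (Rel)
open import Relation.Binary.Structures using (IsStrictPartialOrder)
open import Relation.Binary.PropositionalEquality.Core using (_≡_; _≢_; refl)
open import Relation.Nullary.Decidable.Core using (¬?; toWitness)
open import Relation.Nullary.Negation.Core using (¬_)
open import Relation.Unary using (Pred; _≐_)
open import Function.Bundles using (_⇔_)

-- The real numbers, up to isomorphism: a Cauchy complete Archimedean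
-- ordered field.  The axioms are the constructive ones; read classically
-- they say "complete ordered field".

record OrderedField ℓ ℓ₁ ℓ₂ : Set (suc (ℓ ⊔ ℓ₁ ⊔ ℓ₂)) where
  infix 4 _<_ _≤_
  field
    heytingField : HeytingField ℓ ℓ₁ ℓ₂

  open HeytingField heytingField public

  field
    _<_                  : Rel Carrier ℓ₂
    isStrictPartialOrder : IsStrictPartialOrder _≈_ _<_
    #⇒<⊎>                : ∀ {x y} → x # y → x < y ⊎ y < x
    <⇒#                  : ∀ {x y} → x < y → x # y
    +-monoˡ-<            : ∀ {x y} z → x < y → x + z < y + z
    *-pos                : ∀ {x y} → 0# < x → 0# < y → 0# < x * y

  _≤_ : Rel Carrier ℓ₂
  x ≤ y = ¬ (y < x)

  open HeytingCommutativeRing heytingCommutativeRing public using (commutativeRing)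
  open CommutativeRing commutativeRing public using (rawRing; ring; +-rawMonoid)
  open RawMonoidDefinitions +-rawMonoid public using () renaming (_×_ to _·_)

  ⌜_⌝ : ℕ → Carrier
  ⌜ n ⌝ = n · 1#

  Cauchy : (ℕ → Carrier) → Set (ℓ ⊔ ℓ₂)
  Cauchy x = ∀ {ε} → 0# < ε →
    ∃ λ N → ∀ {m n} → N ℕ.≤ m → N ℕ.≤ n → x m < x n + ε

  ConvergesTo : (ℕ → Carrier) → Carrier → Set (ℓ ⊔ ℓ₂)
  ConvergesTo x l = ∀ {ε} → 0# < ε →
    ∃ λ N → ∀ {n} → N ℕ.≤ n → x n < l + ε × l < x n + ε

-- The square root of a nonnegative number is determined by the last two
-- fields; the value of √ at negative numbers is left open.

record RealNumbers ℓ ℓ₁ ℓ₂ : Set (suc (ℓ ⊔ ℓ₁ ⊔ ℓ₂)) where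
  field
    orderedField : OrderedField ℓ ℓ₁ ℓ₂

  open OrderedField orderedField public

  field
    archimedean : ∀ x → ∃ λ n → x < ⌜ n ⌝
    complete    : ∀ x → Cauchy x → ∃ λ l → ConvergesTo x l
    √           : Carrier → Carrier
    √-nonneg    : ∀ {x} → 0# ≤ x → 0# ≤ √ x
    √-square    : ∀ {x} → 0# ≤ x → √ x * √ x ≈ x

module Division {ℓ ℓ₁ ℓ₂} (R : RealNumbers ℓ ℓ₁ ℓ₂) where

  open RealNumbers R
  open RingProperties ring using (-‿distribˡ-*; -‿distribʳ-*; -‿involutive)
  open HeytingProperties heytingCommutativeRing
    using (x-0≈x; 1#0; #-congʳ; invertibleʳ⇒#)
  private module < = IsStrictPartialOrder isStrictPartialOrder

  inv : ∀ x → x # 0# → Carrier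
  inv x x#0 = proj₁ (#⇒invertible x#0)

  *-inv : ∀ x (x#0 : x # 0#) → x * inv x x#0 ≈ 1#
  *-inv x x#0 =
    trans (*-congʳ (sym (x-0≈x x))) (proj₂ (proj₂ (#⇒invertible x#0)))

  *#0⇒#0 : ∀ x {y} → x * y # 0# → x # 0#
  *#0⇒#0 x {y} xy#0 = invertibleʳ⇒# (y * inv (x * y) xy#0 , trans
    (*-congʳ (x-0≈x x)) (trans (sym (*-assoc x y _)) (*-inv (x * y) xy#0)))

  <0⇒0<- : ∀ {x} → x < 0# → 0# < - x
  <0⇒0<- {x} x<0 =
    <.<-respˡ-≈ (-‿inverseʳ x) (<.<-respʳ-≈ (+-identityˡ (- x)) (+-monoˡ-< (- x) x<0))

  -*-≈ : ∀ x y → - x * - y ≈ x * y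
  -*-≈ x y = trans (sym (-‿distribˡ-* x (- y)))
    (trans (-‿cong (sym (-‿distribʳ-* x y))) (-‿involutive (x * y)))

  x#0⇒0<x² : ∀ {x} → x # 0# → 0# < x * x
  x#0⇒0<x² {x} x#0 with #⇒<⊎> x#0
  ... | inj₂ 0<x = *-pos 0<x 0<x
  ... | inj₁ x<0 = <.<-respʳ-≈ (-*-≈ x x) (*-pos (<0⇒0<- x<0) (<0⇒0<- x<0))

  0<1 : 0# < 1#
  0<1 = <.<-respʳ-≈ (*-identityˡ 1#) (x#0⇒0<x² 1#0)

  0≤x² : ∀ x → 0# ≤ x * x
  0≤x² x x²<0 = <.asym (x#0⇒0<x² (*#0⇒#0 x (<⇒# x²<0))) x²<0

  0<suc : ∀ n → 0# < ⌜ ℕ.suc n ⌝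
  0<suc ℕ.zero    = <.<-respʳ-≈ (sym (+-identityʳ 1#)) 0<1
  0<suc (ℕ.suc n) = <.trans (0<suc n)
    (<.<-respˡ-≈ (+-identityˡ _) (+-monoˡ-< ⌜ ℕ.suc n ⌝ 0<1))

  infixl 7 _/_
  _/_ : Carrier → (n : ℕ) .{{_ : NonZero n}} → Carrier
  x / n@(ℕ.suc m) = x * inv ⌜ n ⌝ (#-sym (<⇒# (0<suc m)))

  0<1+t² : ∀ t → 0# < 1# + t * t
  0<1+t² t with #-cotrans (<⇒# 0<1) (1# + t * t)
  ... | inj₂ z#1 with #⇒<⊎> z#1
  ...   | inj₂ 1<z = <.trans 0<1 1<z
  ...   | inj₁ z<1 = ⊥-elim (0≤x² t (<.<-respˡ-≈ cancel
            (<.<-respʳ-≈ (-‿inverseʳ 1#) (+-monoˡ-< (- 1#) z<1))))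
    where
    cancel : 1# + t * t + - 1# ≈ t * t
    cancel = trans (+-congʳ (+-comm 1# (t * t))) (trans (+-assoc _ _ _)
      (trans (+-congˡ (-‿inverseʳ 1#)) (+-identityʳ _)))
  0<1+t² t | inj₁ 0#z with #⇒<⊎> 0#z
  ...   | inj₁ 0<z = 0<z
  ...   | inj₂ z<0 = ⊥-elim (0≤x² t (<.trans
            (<.<-respˡ-≈ (+-identityˡ _) (+-monoˡ-< (t * t) 0<1)) z<0))

  √[1+t²]#0 : ∀ t → √ (1# + t * t) # 0#
  √[1+t²]#0 t = *#0⇒#0 _ (#-congʳ (sym (√-square (<.asym 0<z))) (#-sym (<⇒# 0<z)))
    where 0<z = 0<1+t² t

module Complex {ℓ ℓ₁ ℓ₂} (R : RealNumbers ℓ ℓ₁ ℓ₂) where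

  open RealNumbers R

  infix 5 _+i_
  record ℂ : Set ℓ where
    constructor _+i_
    field
      re im : Carrier
  open ℂ public

  infix  8 -ᶜ_
  infixl 7 _*ᶜ_
  infixl 6 _+ᶜ_ _-ᶜ_
  infix  4 _≈ᶜ_

  _≈ᶜ_ : Rel ℂ ℓ₁
  z ≈ᶜ w = re z ≈ re w × im z ≈ im w

  _+ᶜ_ _-ᶜ_ _*ᶜ_ : ℂ → ℂ → ℂ
  z +ᶜ w = re z + re w +i im z + im w
  z -ᶜ w = re z - re w +i im z - im w
  z *ᶜ w = re z * re w - im z * im w +i re z * im w + im z * re w

  -ᶜ_ conj : ℂ → ℂ
  -ᶜ z   = - re z +i - im z
  conj z = re z +i - im z

  fromReal : Carrier → ℂ
  fromReal x = x +i 0#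

  0ᶜ 1ᶜ 𝐢 : ℂ
  0ᶜ = fromReal 0#
  1ᶜ = fromReal 1#
  𝐢  = 0# +i 1#

  ℂ-rawRing : RawRing ℓ ℓ₁
  ℂ-rawRing = record
    { Carrier = ℂ ; _≈_ = _≈ᶜ_ ; _+_ = _+ᶜ_ ; _*_ = _*ᶜ_
    ; -_ = -ᶜ_ ; 0# = 0ᶜ ; 1# = 1ᶜ }

  ⟨_,_,_⟩ : ℂ → ℂ → ℂ → Vector ℂ 3
  ⟨ x , y , z ⟩ = x Functional.∷ y Functional.∷ z Functional.∷ Functional.[]

  infixl 7 _⨯_
  _⨯_ : Vector ℂ 3 → Vector ℂ 3 → Vector ℂ 3
  u ⨯ w = ⟨ u₁ *ᶜ w₂ -ᶜ u₂ *ᶜ w₁ , u₂ *ᶜ w₀ -ᶜ u₀ *ᶜ w₂ , u₀ *ᶜ w₁ -ᶜ u₁ *ᶜ w₀ ⟩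
    where
    u₀ = u (# 0); u₁ = u (# 1); u₂ = u (# 2)
    w₀ = w (# 0); w₁ = w (# 1); w₂ = w (# 2)

-- A hyperedge is the set of entries of a listing e with 𝓔 e; the order of
-- the listing plays no role.

record ThreeUniformHypergraph : Set₁ where
  field
    Vertex  : Set
    𝓔       : Pred (Vec Vertex 3) _
    uniform : ∀ {e} → 𝓔 e → Unique e

  InCommonHyperedge : Rel Vertex _
  InCommonHyperedge u v = ∃ λ e → 𝓔 e × u ∈ e × v ∈ e

-- The field ℝ (with trivial conjugation) or ℂ enters only through its
-- operations.

module OrthogonalRepresentation
  {a ℓ} (𝔽 : RawRing a ℓ) (conj : Op₁ (RawRing.Carrier 𝔽)) where

  open RawRing 𝔽
  open RawMonoidDefinitions +-rawMonoid using (sum)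

  inner : ∀ {d} → Vector Carrier d → Vector Carrier d → Carrier
  inner x y = sum (λ k → conj (x k) * y k)

  Zero : ∀ {d} → Pred (Vector Carrier d) ℓ
  Zero x = ∀ k → x k ≈ 0#

  Ray : ∀ {d} → Vector Carrier d → Pred (Vector Carrier d) (a ⊔ ℓ)
  Ray x y = ∃ λ α → ∀ k → y k ≈ α * x k

  record IsFaithful (H : ThreeUniformHypergraph) (d : ℕ)
      (x : ThreeUniformHypergraph.Vertex H → Vector Carrier d)
      : Set (a ⊔ ℓ) where
    open ThreeUniformHypergraph H
    field
      3≤d        : 3 ℕ.≤ d
      nonzero    : ∀ u → ¬ Zero (x u)
      distinct   : ∀ {u v} → u ≢ v → ¬ (Ray (x u) ≐ Ray (x v))
      orthogonal : ∀ {u v} → u ≢ v →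
                   inner (x u) (x v) ≈ 0# ⇔ InCommonHyperedge u v

next prev : Fin 8 → Fin 8
next j = (toℕ j ℕ.+ 1) mod 8
prev j = (toℕ j ℕ.+ 7) mod 8

prev≢ : ∀ j → prev j ≢ j
prev≢ = toWitness {a? = all? λ j → ¬? (prev j ≟ᶠ j)} _

-- v⁺ j is the vertex v_{j,j+1}.

data Vertex₂₀ : Set where
  v v⁺        : Fin 8 → Vertex₂₀
  a₁ a₂ b₁ b₂ : Vertex₂₀

data 𝓔₂₀ : Pred (Vec Vertex₂₀ 3) Level.zero where
  E  : ∀ j → 𝓔₂₀ (v⁺ (prev j) ∷ v j ∷ v⁺ j ∷ [])
  D₀ : 𝓔₂₀ (v (# 0) ∷ a₁ ∷ v (# 4) ∷ [])
  D₂ : 𝓔₂₀ (v (# 2) ∷ a₂ ∷ v (# 6) ∷ [])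
  D₁ : 𝓔₂₀ (v (# 1) ∷ b₂ ∷ v (# 5) ∷ [])
  D₃ : 𝓔₂₀ (v (# 3) ∷ b₁ ∷ v (# 7) ∷ [])

uniform₂₀ : ∀ {e} → 𝓔₂₀ e → Unique e
uniform₂₀ (E j) = ((λ ()) ∷ v⁺-≢ ∷ []) ∷ ((λ ()) ∷ []) ∷ [] ∷ []
  where
  v⁺-injective : ∀ {i k} → v⁺ i ≡ v⁺ k → i ≡ k
  v⁺-injective refl = refl
  v⁺-≢ : v⁺ (prev j) ≢ v⁺ j
  v⁺-≢ = prev≢ j ∘ v⁺-injective
uniform₂₀ D₀ = ((λ ()) ∷ (λ ()) ∷ []) ∷ ((λ ()) ∷ []) ∷ [] ∷ []
uniform₂₀ D₂ = ((λ ()) ∷ (λ ()) ∷ []) ∷ ((λ ()) ∷ []) ∷ [] ∷ []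
uniform₂₀ D₁ = ((λ ()) ∷ (λ ()) ∷ []) ∷ ((λ ()) ∷ []) ∷ [] ∷ []
uniform₂₀ D₃ = ((λ ()) ∷ (λ ()) ∷ []) ∷ ((λ ()) ∷ []) ∷ [] ∷ []

H₂₀ : ThreeUniformHypergraph
H₂₀ = record { Vertex = Vertex₂₀ ; 𝓔 = 𝓔₂₀ ; uniform = uniform₂₀ }

data Vertex₂₁ : Set where
  old : Vertex₂₀ → Vertex₂₁
  c   : Vertex₂₁

old-injective : ∀ {u w} → old u ≡ old w → u ≡ w
old-injective refl = refl

data 𝓔₂₁ : Pred (Vec Vertex₂₁ 3) Level.zero where
  old : ∀ {e} → 𝓔₂₀ e → 𝓔₂₁ (map old e)
  Fa  : 𝓔₂₁ (old a₁ ∷ c ∷ old a₂ ∷ [])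
  Fb  : 𝓔₂₁ (old b₁ ∷ c ∷ old b₂ ∷ [])

uniform₂₁ : ∀ {e} → 𝓔₂₁ e → Unique e
uniform₂₁ (old e) = map⁺ old-injective (uniform₂₀ e)
uniform₂₁ Fa = ((λ ()) ∷ (λ ()) ∷ []) ∷ ((λ ()) ∷ []) ∷ [] ∷ []
uniform₂₁ Fb = ((λ ()) ∷ (λ ()) ∷ []) ∷ ((λ ()) ∷ []) ∷ [] ∷ []

H₂₁ : ThreeUniformHypergraph
H₂₁ = record { Vertex = Vertex₂₁ ; 𝓔 = 𝓔₂₁ ; uniform = uniform₂₁ }

module Realification {ℓ ℓ₁ ℓ₂} (R : RealNumbers ℓ ℓ₁ ℓ₂) where

  open RealNumbers R
  open Division R
  open Complex R

  Φ : Carrier → Vector ℂ 3 → Vector Carrier 6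
  Φ t z = Functional.map (_* inv (√ (1# + t * t)) (√[1+t²]#0 t))
    (Functional._++_ {m = 3} {n = 3}
      (λ k → re (z k) - t * im (z k)) (λ k → im (z k) + t * re (z k)))

module Vectors₂₀ {ℓ ℓ₁ ℓ₂} (R : RealNumbers ℓ ℓ₁ ℓ₂) where

  open RealNumbers R
  open Division R
  open Complex R
  open Realification R

  C s N r : Carrier
  C = (⌜ 49 ⌝ - ⌜ 5 ⌝ * √ ⌜ 69 ⌝) / 26
  s = √ C
  N = 1# + C
  r = √ N

  η ζ sᶜ rᶜ : ℂ
  η  = ⌜ 5 ⌝ / 13 +i ⌜ 12 ⌝ / 13
  ζ  = (⌜ 14 ⌝ + ⌜ 6 ⌝ * √ ⌜ 69 ⌝) / 65 +i (⌜ 4 ⌝ * √ ⌜ 69 ⌝ - ⌜ 21 ⌝) / 65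
  sᶜ = fromReal s
  rᶜ = fromReal r

  μ τ : Fin 8 → ℂ
  μ = lookup (-ᶜ 1ᶜ ∷ η ∷ 1ᶜ ∷ -ᶜ η ∷ -ᶜ 1ᶜ ∷ η ∷ 1ᶜ ∷ -ᶜ η ∷ [])
  τ = lookup (1ᶜ ∷ ζ ∷ -ᶜ 𝐢 ∷ -ᶜ 𝐢 *ᶜ ζ ∷ -ᶜ 1ᶜ ∷ -ᶜ ζ ∷ 𝐢 ∷ 𝐢 *ᶜ ζ ∷ [])

  ψv : Fin 8 → Vector ℂ 3
  ψv j = ⟨ 1ᶜ , sᶜ *ᶜ μ j , rᶜ *ᶜ τ j ⟩

  ψ : Vertex₂₀ → Vector ℂ 3
  ψ (v j)  = ψv j
  ψ (v⁺ j) = Functional.map conj (ψv j ⨯ ψv (next j))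
  ψ a₁     = ⟨ sᶜ , 1ᶜ , 0ᶜ ⟩
  ψ a₂     = ⟨ sᶜ , -ᶜ 1ᶜ , 0ᶜ ⟩
  ψ b₁     = ⟨ sᶜ , η , 0ᶜ ⟩
  ψ b₂     = ⟨ sᶜ , -ᶜ η , 0ᶜ ⟩

  t : Vertex₂₀ → ℕ
  t (v⁺ j) = lookup (0 ∷ 0 ∷ 0 ∷ 1 ∷ 1 ∷ 1 ∷ 2 ∷ 2 ∷ []) j
  t _      = 0

  R₂₀ : Vertex₂₀ → Vector Carrier 6
  R₂₀ u = Φ ⌜ t u ⌝ (ψ u)

module Vectors₂₁ {ℓ ℓ₁ ℓ₂} (R : RealNumbers ℓ ℓ₁ ℓ₂) where

  open RealNumbers R
  open Division R
  open Complex R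
  open Realification R

  √2 p q : Carrier
  √2 = √ ⌜ 2 ⌝
  p  = (√ ⌜ 14 ⌝ + √2) / 4
  q  = (√ ⌜ 14 ⌝ - √2) / 4

  ψv ψv⁺ : Fin 8 → Vector ℂ 3
  ψv = lookup
    ( ⟨ 1ᶜ , -ᶜ 1ᶜ , √2 +i 0#    ⟩
    ∷ ⟨ 1ᶜ , 𝐢     , p +i q      ⟩
    ∷ ⟨ 1ᶜ , 1ᶜ    , 0# +i - √2  ⟩
    ∷ ⟨ 1ᶜ , -ᶜ 𝐢  , q +i - p    ⟩
    ∷ ⟨ 1ᶜ , -ᶜ 1ᶜ , - √2 +i 0#  ⟩
    ∷ ⟨ 1ᶜ , 𝐢     , - p +i - q  ⟩
    ∷ ⟨ 1ᶜ , 1ᶜ    , 0# +i √2    ⟩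
    ∷ ⟨ 1ᶜ , -ᶜ 𝐢  , - q +i p    ⟩
    ∷ [])
  ψv⁺ = lookup
    ( ⟨ - p +i q + √2       , √2 - p +i q       , 1# +i - 1#   ⟩
    ∷ ⟨ √2 - p +i q         , p +i - (q + √2)   , 1# +i 1#     ⟩
    ∷ ⟨ q + √2 +i p         , - q +i √2 - p     , - 1# +i 1#   ⟩
    ∷ ⟨ q +i p - √2         , q + √2 +i p       , - 1# +i - 1# ⟩
    ∷ ⟨ p +i - (q + √2)     , - √2 + p +i - q   , 1# +i - 1#   ⟩
    ∷ ⟨ - √2 + p +i - q     , - p +i q + √2     , 1# +i 1#     ⟩
    ∷ ⟨ - q - √2 +i - p     , q +i - (√2 - p)   , - 1# +i 1#   ⟩
    ∷ ⟨ - q +i - (p - √2)   , - q - √2 +i - p   , - 1# +i - 1# ⟩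
    ∷ [])

  ψ : Vertex₂₁ → Vector ℂ 3
  ψ c            = ⟨ 0ᶜ , 0ᶜ , 1ᶜ ⟩
  ψ (old a₁)     = ⟨ 1ᶜ , 1ᶜ , 0ᶜ ⟩
  ψ (old a₂)     = ⟨ 1ᶜ , -ᶜ 1ᶜ , 0ᶜ ⟩
  ψ (old b₁)     = ⟨ 1ᶜ , 𝐢 , 0ᶜ ⟩
  ψ (old b₂)     = ⟨ 1ᶜ , -ᶜ 𝐢 , 0ᶜ ⟩
  ψ (old (v j))  = ψv j
  ψ (old (v⁺ j)) = ψv⁺ j

  t : Vertex₂₁ → ℕ
  t (old (v j))  = lookup (0 ∷ 0 ∷ 2 ∷ 2 ∷ 0 ∷ 0 ∷ 2 ∷ 2 ∷ []) j
  t (old (v⁺ j)) = lookup (0 ∷ 0 ∷ 0 ∷ 2 ∷ 1 ∷ 2 ∷ 3 ∷ 2 ∷ []) j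
  t _            = 0

  R₂₁ : Vertex₂₁ → Vector Carrier 6
  R₂₁ u = Φ ⌜ t u ⌝ (ψ u)

module _ {ℓ ℓ₁ ℓ₂} (R : RealNumbers ℓ ℓ₁ ℓ₂) where

  open RealNumbers R

  IsFaithfulOrthogonalRepresentation : (H : ThreeUniformHypergraph) (d : ℕ) →
    (ThreeUniformHypergraph.Vertex H → Vector Carrier d) → Set (ℓ ⊔ ℓ₁)
  IsFaithfulOrthogonalRepresentation =
    OrthogonalRepresentation.IsFaithful rawRing (λ x → x)

{-# OPTIONS --safe #-}
module Submission where

-- All coordinates lie, up to the factors 1/√(1+t²), in ℤ[1/130][√69][s][r]
-- and ℤ[1/4][√2][√14] respectively, where arithmetic is effective: an
-- element a + b√d vanishes if a and b do, and cannot vanish if its norm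
-- a² - d b² does not.  So every inner product can be tested by computation.
-- Distinctness of rays then needs no further computation in ℝ: for u ≢ w
-- some neighbour z of u is orthogonal to x u, but equals w or is not a
-- neighbour of w, hence is not orthogonal to x w.

open import Level using (Level; _⊔_)
open import Algebra.Bundles using (CommutativeRing)
open import Algebra.Core using (Op₁; Op₂)
import Algebra.Apartness.Properties.HeytingCommutativeRing as HeytingProperties
open import Data.Bool.Base using (Bool; T; _∧_)
open import Data.Bool.Properties using (T-∧)
open import Data.Fin.Base using (Fin; toℕ; splitAt)
open import Data.Fin.Patterns
open import Data.Fin.Properties using (+↔⊎; toℕ-injective)
  renaming (_≟_ to _≟ᶠ_; all? to allᶠ?; any? to anyᶠ?)
open import Data.Integer.Base as ℤ using (ℤ; +_; -[1+_])
import Data.Integer.Properties as ℤ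
open import Data.List.Base as List using (List; []; _∷_; _++_; allFin)
open import Data.List.Membership.Propositional using (find; lose) renaming (_∈_ to _∈ˡ_)
open import Data.List.Membership.Propositional.Properties
  using (∈-++⁺ˡ; ∈-++⁺ʳ; ∈-map⁺; ∈-allFin)
open import Data.List.Relation.Unary.All as All using (All; []; _∷_)
import Data.List.Relation.Unary.All.Properties as All
open import Data.List.Relation.Unary.Any using (Any; here; there; any?)
import Data.List.Relation.Unary.Any.Properties as Anyˡ
open import Data.Nat.Base as ℕ using (ℕ; NonZero)
import Data.Nat.DivMod as ℕ
import Data.Nat.Properties as ℕ
open import Data.Product.Base using (∃; _×_; _,_; proj₁; proj₂)
open import Data.Sum.Base as Sum using (_⊎_; inj₁; inj₂)
open import Data.Sum.Function.Propositional using (_⊎-↔_)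
open import Data.Vec.Base as Vec using (Vec; []; _∷_)
open import Data.Vec.Functional as Functional using (Vector)
open import Data.Vec.Membership.DecPropositional ℕ._≟_ using (_∈?_)
open import Data.Vec.Membership.Propositional using () renaming (_∈_ to _∈ᵛ_)
open import Data.Vec.Membership.Propositional.Properties using () renaming (∈-map⁺ to ∈-map⁺ᵛ)
open import Data.Vec.Properties using (lookup∘tabulate)
import Data.Vec.Relation.Unary.Any as Any
import Data.Vec.Relation.Unary.Any.Properties as Any
open import Function.Base using (_∘_)
open import Function.Bundles using (_⇔_; _↔_; mk⇔; mk↔ₛ′; Equivalence; Injection; Inverse)
open import Function.Properties.Inverse using (↔-refl; ↔-sym; ↔-trans; ↔⇒↣)
open import Relation.Binary.Core using (Rel)
open import Relation.Binary.Definitions using (Decidable)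
open import Relation.Binary.PropositionalEquality.Core as ≡ using (_≡_; _≢_)
open import Relation.Binary.Structures using (IsStrictPartialOrder)
open import Relation.Nullary.Decidable
  using (Dec; True; yes; no; T?; toWitness; ¬?; _×-dec_; _⊎-dec_; _→-dec_)
open import Relation.Nullary.Negation.Core using (¬_; contradiction)
open import Relation.Unary using (_≐_)
open import Defs

-- Finite listings of hypergraphs and separation of vertices.

record Listing (H : ThreeUniformHypergraph) : Set where
  open ThreeUniformHypergraph H
  field
    order    : ℕ
    vertices : Vertex ↔ Fin order
    edges    : List (Vec Vertex 3)
    edges⁺   : ∀ {e} → 𝓔 e → e ∈ˡ edges
    edges⁻   : All 𝓔 edges

  open Inverse vertices public using () renaming (to to index; from to vertex)
  open Inverse vertices using (strictlyInverseˡ; strictlyInverseʳ)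

  label : Vertex → ℕ
  label u = toℕ (index u)

  -- The edges again, but as numerals, on which membership is fast to decide.
  field
    labels     : List (Vec ℕ 3)
    map-labels : List.map (Vec.map label) edges ≡ labels

  vertex-index : ∀ u → vertex (index u) ≡ u
  vertex-index = strictlyInverseʳ

  index-injective : ∀ {u w} → index u ≡ index w → u ≡ w
  index-injective = Injection.injective (↔⇒↣ vertices)

  Joins : ℕ → ℕ → Vec ℕ 3 → Set
  Joins m n e = m ∈ᵛ e × n ∈ᵛ e

  infix 4 _~_ _~?_

  _~_ : Rel (Fin order) _
  i ~ j = Any (Joins (toℕ i) (toℕ j)) labels

  _~?_ : Decidable _~_
  i ~? j = connected? (toℕ i) (toℕ j)
    where
    -- Abstracting over the two numerals lets the tests against all edges share their evaluation.
    connected? : ∀ m n → Dec (Any (Joins m n) labels)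
    connected? m n = any? (λ e → m ∈? e ×-dec n ∈? e) labels

  label-∈ : ∀ {u n} {e : Vec Vertex n} → label u ∈ᵛ Vec.map label e → u ∈ᵛ e
  label-∈ l∈ = Any.map (index-injective ∘ toℕ-injective) (Any.map⁻ l∈)

  -- `map-labels` carries a search among numerals back to the edges, and injectivity of `label`
  -- recovers the vertices from their numerals.
  ~⇔ : ∀ {u w} → index u ~ index w ⇔ InCommonHyperedge u w
  ~⇔ {u} {w} = mk⇔
    (λ u~w → let
        e , e∈edges , u∈ , w∈ = find (Anyˡ.map⁻
          (≡.subst (Any (Joins (label u) (label w))) (≡.sym map-labels) u~w))
      in e , All.lookup edges⁻ e∈edges , label-∈ u∈ , label-∈ w∈)
    (λ (e , e∈𝓔 , u∈ , w∈) → ≡.subst (Any (Joins (label u) (label w))) map-labels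
      (Anyˡ.map⁺ (lose (edges⁺ e∈𝓔) (∈-map⁺ᵛ label u∈ , ∈-map⁺ᵛ label w∈))))

  -- i and j cannot share a ray: k would be orthogonal to both.
  Separated : Rel (Fin order) _
  Separated i j = ∃ λ k → k ~ i × k ≢ i × (k ≡ j ⊎ ¬ k ~ j)

  Separating : Set
  Separating = ∀ i j → i ≢ j → Separated i j

  separating? : Dec Separating
  separating? = allᶠ? λ i → allᶠ? λ j → ¬? (i ≟ᶠ j) →-dec
    anyᶠ? λ k → (k ~? i) ×-dec ¬? (k ≟ᶠ i) ×-dec (k ≟ᶠ j ⊎-dec ¬? (k ~? j))

  -- Moves the outcome of the finite search from indices to vertices. The vertex `z` will be
  -- orthogonal to the vector of `u` but not to that of `w`.
  separate : Separating → ∀ {u w} → u ≢ w → ∃ λ z →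
    InCommonHyperedge z u × z ≢ u × (z ≡ w ⊎ ¬ InCommonHyperedge z w)
  separate sep {u} {w} u≢w with sep (index u) (index w) (u≢w ∘ index-injective)
  ... | k , k~u , k≢u , alternative = vertex k
    , Equivalence.to ~⇔ (≡.subst (_~ index u) (≡.sym k≡) k~u)
    , (λ eq → k≢u (≡.trans (≡.sym k≡) (≡.cong index eq)))
    , Sum.map (λ k≡w → ≡.trans (≡.cong vertex k≡w) (vertex-index w))
        (λ k≁w z~w → k≁w (≡.subst (_~ index w) k≡ (Equivalence.from ~⇔ z~w))) alternative
    where
    k≡ : index (vertex k) ≡ k
    k≡ = strictlyInverseˡ k

-- The listings of the two hypergraphs.

listing₂₀ : Listing H₂₀
listing₂₀ = record
  { order    = 20
  ; vertices = ↔-trans split (↔-trans (↔-refl ⊎-↔ (↔-sym +↔⊎)) (↔-sym +↔⊎))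
  ; edges    = List.map E-edge (allFin 8) ++ D-edges
  ; edges⁺   = listed
  ; edges⁻   = All.++⁺ (All.map⁺ (All.universal E (allFin 8))) (D₀ ∷ D₂ ∷ D₁ ∷ D₃ ∷ [])
  ; labels   = labels
  ; map-labels = ≡.refl
  }
  where
  split : Vertex₂₀ ↔ (Fin 8 ⊎ (Fin 8 ⊎ Fin 4))
  split = mk↔ₛ′
    (λ { (v j) → inj₁ j ; (v⁺ j) → inj₂ (inj₁ j)
       ; a₁ → inj₂ (inj₂ 0F) ; a₂ → inj₂ (inj₂ 1F) ; b₁ → inj₂ (inj₂ 2F) ; b₂ → inj₂ (inj₂ 3F) })
    (λ { (inj₁ j) → v j ; (inj₂ (inj₁ j)) → v⁺ j
       ; (inj₂ (inj₂ 0F)) → a₁ ; (inj₂ (inj₂ 1F)) → a₂ ; (inj₂ (inj₂ 2F)) → b₁ ; (inj₂ (inj₂ 3F)) → b₂ })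
    (λ { (inj₁ j) → ≡.refl ; (inj₂ (inj₁ j)) → ≡.refl
       ; (inj₂ (inj₂ 0F)) → ≡.refl ; (inj₂ (inj₂ 1F)) → ≡.refl
       ; (inj₂ (inj₂ 2F)) → ≡.refl ; (inj₂ (inj₂ 3F)) → ≡.refl })
    (λ { (v j) → ≡.refl ; (v⁺ j) → ≡.refl ; a₁ → ≡.refl ; a₂ → ≡.refl ; b₁ → ≡.refl ; b₂ → ≡.refl })

  E-edge : Fin 8 → Vec Vertex₂₀ 3
  E-edge j = v⁺ (prev j) ∷ v j ∷ v⁺ j ∷ []

  D-edges : List (Vec Vertex₂₀ 3)
  D-edges = (v 0F ∷ a₁ ∷ v 4F ∷ []) ∷ (v 2F ∷ a₂ ∷ v 6F ∷ [])
          ∷ (v 1F ∷ b₂ ∷ v 5F ∷ []) ∷ (v 3F ∷ b₁ ∷ v 7F ∷ []) ∷ []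

  -- v j, v⁺ j, a₁, a₂, b₁, b₂ have labels j, 8 + j, 16, 17, 18, 19.
  labels : List (Vec ℕ 3)
  labels = (15 ∷ 0 ∷ 8  ∷ []) ∷ (8  ∷ 1 ∷ 9  ∷ []) ∷ (9  ∷ 2 ∷ 10 ∷ []) ∷ (10 ∷ 3 ∷ 11 ∷ [])
         ∷ (11 ∷ 4 ∷ 12 ∷ []) ∷ (12 ∷ 5 ∷ 13 ∷ []) ∷ (13 ∷ 6 ∷ 14 ∷ []) ∷ (14 ∷ 7 ∷ 15 ∷ [])
         ∷ (0 ∷ 16 ∷ 4 ∷ []) ∷ (2 ∷ 17 ∷ 6 ∷ []) ∷ (1 ∷ 19 ∷ 5 ∷ []) ∷ (3 ∷ 18 ∷ 7 ∷ []) ∷ []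

  D-listed : ∀ {e} → e ∈ˡ D-edges → e ∈ˡ List.map E-edge (allFin 8) ++ D-edges
  D-listed = ∈-++⁺ʳ (List.map E-edge (allFin 8))

  listed : ∀ {e} → 𝓔₂₀ e → e ∈ˡ List.map E-edge (allFin 8) ++ D-edges
  listed (E j) = ∈-++⁺ˡ (∈-map⁺ E-edge (∈-allFin j))
  listed D₀    = D-listed (here ≡.refl)
  listed D₂    = D-listed (there (here ≡.refl))
  listed D₁    = D-listed (there (there (here ≡.refl)))
  listed D₃    = D-listed (there (there (there (here ≡.refl))))

-- `c` comes first, so it takes label 0 and every old label moves up by one; the numerals of
-- `listing₂₀` are then reused through `ℕ.suc`.
listing₂₁ : Listing H₂₁
listing₂₁ = record
  { order    = 21
  ; vertices = ↔-trans split (↔-trans (↔-refl ⊎-↔ vertices) (↔-sym +↔⊎))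
  ; edges    = Fa-edge ∷ Fb-edge ∷ List.map (Vec.map old) edges
  ; edges⁺   = λ { (old e) → there (there (∈-map⁺ (Vec.map old) (edges⁺ e)))
                 ; Fa → here ≡.refl ; Fb → there (here ≡.refl) }
  ; edges⁻   = Fa ∷ Fb ∷ All.map⁺ (All.map old edges⁻)
  ; labels   = (17 ∷ 0 ∷ 18 ∷ []) ∷ (19 ∷ 0 ∷ 20 ∷ []) ∷ List.map (Vec.map ℕ.suc) labels
  ; map-labels = ≡.refl
  }
  where
  open Listing listing₂₀

  Fa-edge Fb-edge : Vec Vertex₂₁ 3
  Fa-edge = old a₁ ∷ c ∷ old a₂ ∷ []
  Fb-edge = old b₁ ∷ c ∷ old b₂ ∷ []

  split : Vertex₂₁ ↔ (Fin 1 ⊎ Vertex₂₀)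
  split = mk↔ₛ′
    (λ { c → inj₁ 0F ; (old u) → inj₂ u })
    (λ { (inj₁ 0F) → c ; (inj₂ u) → old u })
    (λ { (inj₁ 0F) → ≡.refl ; (inj₂ u) → ≡.refl })
    (λ { c → ≡.refl ; (old u) → ≡.refl })

-- Adjacent `i` and `j` are separated by `k = j` itself. For the remaining pairs the search has to
-- find a neighbour of `i` that is not joined to `j`.
separating₂₀ : Listing.Separating listing₂₀
separating₂₀ = toWitness {a? = Listing.separating? listing₂₀} _

separating₂₁ : Listing.Separating listing₂₁
separating₂₁ = toWitness {a? = Listing.separating? listing₂₁} _

-- Computable subrings of the real numbers.

module RealArithmetic {ℓ ℓ₁ ℓ₂} (R : RealNumbers ℓ ℓ₁ ℓ₂) where

  open RealNumbers R
  open Division R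
  open CommutativeRing commutativeRing using (semiring; commutativeSemiring)
  open import Algebra.Properties.Ring ring 
    using (-‿distribˡ-*; -‿distribʳ-*; -‿involutive; -0#≈0#; -‿+-comm; +-inverseˡ-unique)
  open import Algebra.Properties.Semiring.Mult semiring using (×-homo-+; ×1-homo-*)
  open import Algebra.Solver.Ring.NaturalCoefficients.Default commutativeSemiring
    using (solve; _:+_; _:*_; _:=_)
  open import Relation.Binary.Reasoning.Setoid setoid
  open HeytingProperties heytingCommutativeRing using (#-congʳ)
  module < = IsStrictPartialOrder isStrictPartialOrder

  -- Only soundness of the two tests is required: both may fail on a code.
  record ComputableSubring : Set (Level.suc (ℓ ⊔ ℓ₁)) where
    infix  8 ⊝_
    infixl 7 _⊛_
    infixl 6 _⊕_
    field
      Code     : Set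
      ⟦_⟧      : Code → Carrier
      numeral  : ℕ → Code
      _⊕_ _⊛_  : Op₂ Code
      ⊝_       : Op₁ Code
      zero? nonzero? : Code → Bool
      numeral-≈ : ∀ n → ⟦ numeral n ⟧ ≈ ⌜ n ⌝
      ⊕-≈       : ∀ a b → ⟦ a ⊕ b ⟧ ≈ ⟦ a ⟧ + ⟦ b ⟧
      ⊛-≈       : ∀ a b → ⟦ a ⊛ b ⟧ ≈ ⟦ a ⟧ * ⟦ b ⟧
      ⊝-≈       : ∀ a → ⟦ ⊝ a ⟧ ≈ - ⟦ a ⟧
      zero-sound    : ∀ a → T (zero? a) → ⟦ a ⟧ ≈ 0#
      nonzero-sound : ∀ a → T (nonzero? a) → ¬ ⟦ a ⟧ ≈ 0#

  infix 4 _codes_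

  -- Indexed by the real number itself, so that retracing an expression with coded operations yields
  -- its code and the soundness proof at once.
  record Coded (A : ComputableSubring) (x : Carrier) : Set ℓ₁ where
    constructor _codes_
    open ComputableSubring A
    field
      code  : Code
      sound : ⟦ code ⟧ ≈ x
  open Coded public

  +-pos : ∀ {x y} → 0# < x → 0# < y → 0# < x + y
  +-pos {x} {y} 0<x 0<y = <.trans 0<y (<.<-respˡ-≈ (+-identityˡ y) (+-monoˡ-< y 0<x))

  -- `x` is apart from 0 because the product is. If `x` were negative, `x * y` and its negative
  -- would both be positive, yet they sum to 0.
  positive-factor : ∀ {x y} → 0# < y → 0# < x * y → 0# < x
  positive-factor {x} {y} 0<y 0<xy with #⇒<⊎> (*#0⇒#0 x (#-sym (<⇒# 0<xy)))
  ... | inj₂ 0<x = 0<x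
  ... | inj₁ x<0 = contradiction
    (+-pos 0<xy (<.<-respʳ-≈ (sym (-‿distribˡ-* x y)) (*-pos (<0⇒0<- x<0) 0<y)))
    (<.irrefl (sym (-‿inverseʳ (x * y))))

  -- The root is apart from 0 because its square is, and `√-nonneg` excludes the negative side.
  √-pos : ∀ {x} → 0# < x → 0# < √ x
  √-pos {x} 0<x with #⇒<⊎> (*#0⇒#0 (√ x) (#-congʳ (sym (√-square (<.asym 0<x))) (#-sym (<⇒# 0<x))))
  ... | inj₂ 0<√x = 0<√x
  ... | inj₁ √x<0 = contradiction √x<0 (√-nonneg (<.asym 0<x))

  √⌜⌝-square : ∀ n → √ ⌜ ℕ.suc n ⌝ * √ ⌜ ℕ.suc n ⌝ ≈ ⌜ ℕ.suc n ⌝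
  √⌜⌝-square n = √-square (<.asym (0<suc n))

  ⌜1⌝≈1 : ⌜ 1 ⌝ ≈ 1#
  ⌜1⌝≈1 = +-identityʳ 1#

  ⟦_⟧ℤ : ℤ → Carrier
  ⟦ + n ⟧ℤ      = ⌜ n ⌝
  ⟦ -[1+ n ] ⟧ℤ = - ⌜ ℕ.suc n ⌝

  ℤ-neg : ∀ i → ⟦ ℤ.- i ⟧ℤ ≈ - ⟦ i ⟧ℤ
  ℤ-neg (+ ℕ.zero)  = sym -0#≈0#
  ℤ-neg (+ ℕ.suc n) = refl
  ℤ-neg -[1+ n ]    = sym (-‿involutive _)

  ℤ-⊖ : ∀ m n → ⟦ m ℤ.⊖ n ⟧ℤ ≈ ⌜ m ⌝ - ⌜ n ⌝
  ℤ-⊖ ℕ.zero    ℕ.zero    = sym (-‿inverseʳ 0#)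
  ℤ-⊖ ℕ.zero    (ℕ.suc n) = sym (+-identityˡ _)
  ℤ-⊖ (ℕ.suc m) ℕ.zero    = sym (trans (+-congˡ -0#≈0#) (+-identityʳ _))
  ℤ-⊖ (ℕ.suc m) (ℕ.suc n) = begin
    ⟦ ℕ.suc m ℤ.⊖ ℕ.suc n ⟧ℤ            ≡⟨ ≡.cong ⟦_⟧ℤ (ℤ.[1+m]⊖[1+n]≡m⊖n m n) ⟩
    ⟦ m ℤ.⊖ n ⟧ℤ                        ≈⟨ ℤ-⊖ m n ⟩
    -- A zero is inserted as 1 - 1; its two halves then complete `⌜ m ⌝` and `⌜ n ⌝` to the numerals
    -- of the successors.
    ⌜ m ⌝ - ⌜ n ⌝                       ≈⟨ +-identityˡ _ ⟨
    0# + (⌜ m ⌝ - ⌜ n ⌝)                ≈⟨ +-congʳ (-‿inverseʳ 1#) ⟨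
    1# - 1# + (⌜ m ⌝ - ⌜ n ⌝)
      ≈⟨ solve 4 (λ a b c d → (a :+ b) :+ (c :+ d) := (a :+ c) :+ (b :+ d)) refl 1# (- 1#) ⌜ m ⌝ (- ⌜ n ⌝) ⟩
    ⌜ ℕ.suc m ⌝ + (- 1# - ⌜ n ⌝)        ≈⟨ +-congˡ (-‿+-comm 1# ⌜ n ⌝) ⟩
    ⌜ ℕ.suc m ⌝ - ⌜ ℕ.suc n ⌝           ∎

  ℤ-+ : ∀ i j → ⟦ i ℤ.+ j ⟧ℤ ≈ ⟦ i ⟧ℤ + ⟦ j ⟧ℤ
  ℤ-+ (+ m)    (+ n)    = ×-homo-+ 1# m n
  ℤ-+ (+ m)    -[1+ n ] = ℤ-⊖ m (ℕ.suc n)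
  ℤ-+ -[1+ m ] (+ n)    = trans (ℤ-⊖ n (ℕ.suc m)) (+-comm _ _)
  ℤ-+ -[1+ m ] -[1+ n ] = begin
    - ⌜ ℕ.suc (ℕ.suc (m ℕ.+ n)) ⌝      ≡⟨ ≡.cong (λ k → - ⌜ ℕ.suc k ⌝) (ℕ.+-suc m n) ⟨
    - ⌜ ℕ.suc m ℕ.+ ℕ.suc n ⌝          ≈⟨ -‿cong (×-homo-+ 1# (ℕ.suc m) (ℕ.suc n)) ⟩
    - (⌜ ℕ.suc m ⌝ + ⌜ ℕ.suc n ⌝)      ≈⟨ -‿+-comm _ _ ⟨
    - ⌜ ℕ.suc m ⌝ - ⌜ ℕ.suc n ⌝        ∎

  -- `-[1+ n ]` is by computation the negative of `+ ℕ.suc n`, so the sign can be moved out of the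
  -- product, which leaves a product of naturals. `ℤ-*` treats the first factor likewise.
  ℤ-*⁺ : ∀ m j → ⟦ + m ℤ.* j ⟧ℤ ≈ ⌜ m ⌝ * ⟦ j ⟧ℤ
  ℤ-*⁺ m (+ n) = trans (reflexive (≡.cong ⟦_⟧ℤ (≡.sym (ℤ.pos-* m n)))) (×1-homo-* m n)
  ℤ-*⁺ m -[1+ n ] = begin
    ⟦ + m ℤ.* ℤ.- (+ ℕ.suc n) ⟧ℤ    ≡⟨ ≡.cong ⟦_⟧ℤ (ℤ.neg-distribʳ-* (+ m) (+ ℕ.suc n)) ⟨
    ⟦ ℤ.- (+ m ℤ.* + ℕ.suc n) ⟧ℤ    ≈⟨ ℤ-neg (+ m ℤ.* + ℕ.suc n) ⟩
    - ⟦ + m ℤ.* + ℕ.suc n ⟧ℤ        ≈⟨ -‿cong (ℤ-*⁺ m (+ ℕ.suc n)) ⟩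
    - (⌜ m ⌝ * ⌜ ℕ.suc n ⌝)         ≈⟨ -‿distribʳ-* _ _ ⟩
    ⌜ m ⌝ * - ⌜ ℕ.suc n ⌝           ∎

  ℤ-* : ∀ i j → ⟦ i ℤ.* j ⟧ℤ ≈ ⟦ i ⟧ℤ * ⟦ j ⟧ℤ
  ℤ-* (+ m)    j = ℤ-*⁺ m j
  ℤ-* -[1+ m ] j = begin
    ⟦ ℤ.- (+ ℕ.suc m) ℤ.* j ⟧ℤ      ≡⟨ ≡.cong ⟦_⟧ℤ (ℤ.neg-distribˡ-* (+ ℕ.suc m) j) ⟨
    ⟦ ℤ.- (+ ℕ.suc m ℤ.* j) ⟧ℤ      ≈⟨ ℤ-neg (+ ℕ.suc m ℤ.* j) ⟩
    - ⟦ + ℕ.suc m ℤ.* j ⟧ℤ          ≈⟨ -‿cong (ℤ-*⁺ (ℕ.suc m) j) ⟩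
    - (⌜ ℕ.suc m ⌝ * ⟦ j ⟧ℤ)        ≈⟨ -‿distribˡ-* _ _ ⟩
    - ⌜ ℕ.suc m ⌝ * ⟦ j ⟧ℤ          ∎

  suc≉0 : ∀ n → ¬ ⌜ ℕ.suc n ⌝ ≈ 0#
  suc≉0 n eq = <.irrefl (sym eq) (0<suc n)

  integers : ComputableSubring
  integers = record
    { Code = ℤ ; ⟦_⟧ = ⟦_⟧ℤ ; numeral = +_
    ; _⊕_ = ℤ._+_ ; _⊛_ = ℤ._*_ ; ⊝_ = ℤ.-_
    ; zero? = λ i → ℤ.∣ i ∣ ℕ.≡ᵇ 0
    ; nonzero? = λ i → 0 ℕ.<ᵇ ℤ.∣ i ∣
    ; numeral-≈ = λ _ → refl
    ; ⊕-≈ = ℤ-+ ; ⊛-≈ = ℤ-* ; ⊝-≈ = ℤ-neg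
    ; zero-sound = λ { (+ ℕ.zero) _ → refl }
    ; nonzero-sound = λ
        { (+ ℕ.suc n) _ → suc≉0 n
        ; -[1+ n ] _ eq → suc≉0 n (trans (sym (-‿involutive _)) (trans (-‿cong eq) -0#≈0#)) }
    }

  -- A[1/d], with codes (a , e) for a / dᵉ.
  module Localise (A : ComputableSubring) (d : ComputableSubring.Code A) (δ : Carrier)
    (dδ≈1 : ComputableSubring.⟦_⟧ A d * δ ≈ 1#) where

    open ComputableSubring A

    d^_ : ℕ → Code
    d^ ℕ.zero  = numeral 1
    d^ ℕ.suc e = d ⊛ d^ e

    δ^_ : ℕ → Carrier
    δ^ ℕ.zero  = 1#
    δ^ ℕ.suc e = δ * δ^ e

    ⟦d^0⟧ : ⟦ d^ 0 ⟧ ≈ 1#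
    ⟦d^0⟧ = trans (numeral-≈ 1) ⌜1⌝≈1

    δ^-+ : ∀ e f → δ^ (e ℕ.+ f) ≈ δ^ e * δ^ f
    δ^-+ ℕ.zero    f = sym (*-identityˡ _)
    δ^-+ (ℕ.suc e) f = trans (*-congˡ (δ^-+ e f)) (sym (*-assoc _ _ _))

    -- Truncated subtraction covers both orders: if `f` exceeds `e`, the surplus powers of `δ` are
    -- cancelled by those of `d`; otherwise the power of `d` is 1 and the maximum is `e`.
    d^δ^ : ∀ e f → ⟦ d^ (f ℕ.∸ e) ⟧ * δ^ (e ℕ.⊔ f) ≈ δ^ e
    d^δ^ ℕ.zero    ℕ.zero    = trans (*-congʳ ⟦d^0⟧) (*-identityˡ _)
    d^δ^ ℕ.zero    (ℕ.suc f) = begin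
      ⟦ d ⊛ d^ f ⟧ * (δ * δ^ f)         ≈⟨ *-congʳ (⊛-≈ d (d^ f)) ⟩
      ⟦ d ⟧ * ⟦ d^ f ⟧ * (δ * δ^ f)
        ≈⟨ solve 4 (λ a b c d → (a :* b) :* (c :* d) := (a :* c) :* (b :* d)) refl ⟦ d ⟧ ⟦ d^ f ⟧ δ (δ^ f) ⟩
      ⟦ d ⟧ * δ * (⟦ d^ f ⟧ * δ^ f)     ≈⟨ *-cong dδ≈1 (d^δ^ 0 f) ⟩
      1# * 1#                           ≈⟨ *-identityˡ _ ⟩
      1#                                ∎
    d^δ^ (ℕ.suc e) ℕ.zero    = trans (*-congʳ ⟦d^0⟧) (*-identityˡ _)
    d^δ^ (ℕ.suc e) (ℕ.suc f) = begin
      ⟦ d^ (f ℕ.∸ e) ⟧ * (δ * δ^ (e ℕ.⊔ f))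
        ≈⟨ solve 3 (λ a b c → a :* (b :* c) := b :* (a :* c)) refl _ _ _ ⟩
      δ * (⟦ d^ (f ℕ.∸ e) ⟧ * δ^ (e ℕ.⊔ f))  ≈⟨ *-congˡ (d^δ^ e f) ⟩
      δ * δ^ e                               ∎

    value : Code × ℕ → Carrier
    value (a , e) = ⟦ a ⟧ * δ^ e

    -- The common denominator is the larger of the two powers. Fractions are never reduced, as the
    -- tests look only at numerators.
    add mul : Op₂ (Code × ℕ)
    add (a , e) (b , f) = a ⊛ d^ (f ℕ.∸ e) ⊕ b ⊛ d^ (e ℕ.∸ f) , e ℕ.⊔ f
    mul (a , e) (b , f) = a ⊛ b , e ℕ.+ f

    rescale : ∀ a e f → ⟦ a ⊛ d^ (f ℕ.∸ e) ⟧ * δ^ (e ℕ.⊔ f) ≈ value (a , e)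
    rescale a e f = trans (*-congʳ (⊛-≈ a _)) (trans (*-assoc _ _ _) (*-congˡ (d^δ^ e f)))

    add-≈ : ∀ x y → value (add x y) ≈ value x + value y
    add-≈ (a , e) (b , f) = begin
      ⟦ a ⊛ d^ (f ℕ.∸ e) ⊕ b ⊛ d^ (e ℕ.∸ f) ⟧ * δ^ (e ℕ.⊔ f)
        ≈⟨ trans (*-congʳ (⊕-≈ _ _)) (distribʳ _ _ _) ⟩
      ⟦ a ⊛ d^ (f ℕ.∸ e) ⟧ * δ^ (e ℕ.⊔ f) + ⟦ b ⊛ d^ (e ℕ.∸ f) ⟧ * δ^ (e ℕ.⊔ f)
        ≈⟨ +-congˡ (reflexive (≡.cong (λ m → ⟦ b ⊛ d^ (e ℕ.∸ f) ⟧ * δ^ m) (ℕ.⊔-comm e f))) ⟩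
      ⟦ a ⊛ d^ (f ℕ.∸ e) ⟧ * δ^ (e ℕ.⊔ f) + ⟦ b ⊛ d^ (e ℕ.∸ f) ⟧ * δ^ (f ℕ.⊔ e)
        ≈⟨ +-cong (rescale a e f) (rescale b f e) ⟩
      ⟦ a ⟧ * δ^ e + ⟦ b ⟧ * δ^ f ∎

    mul-≈ : ∀ x y → value (mul x y) ≈ value x * value y
    mul-≈ (a , e) (b , f) = trans (*-cong (⊛-≈ a b) (δ^-+ e f))
      (solve 4 (λ a b c d → (a :* b) :* (c :* d) := (a :* c) :* (b :* d)) refl _ _ _ _)

    subring : ComputableSubring
    subring = record
      { Code = Code × ℕ ; ⟦_⟧ = value ; numeral = λ n → numeral n , 0
      ; _⊕_ = add ; _⊛_ = mul ; ⊝_ = λ (a , e) → ⊝ a , e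
      ; zero? = zero? ∘ proj₁ ; nonzero? = nonzero? ∘ proj₁
      ; numeral-≈ = λ n → trans (*-identityʳ _) (numeral-≈ n)
      ; ⊕-≈ = add-≈ ; ⊛-≈ = mul-≈
      ; ⊝-≈ = λ (a , e) → trans (*-congʳ (⊝-≈ a)) (sym (-‿distribˡ-* _ _))
      ; zero-sound = λ (a , e) a≡0 → trans (*-congʳ (zero-sound a a≡0)) (zeroˡ _)
      -- Multiplying a vanishing fraction by its denominator makes the numerator vanish; `d^δ^ 0 e`
      -- says that the `e`-th powers of `d` and `δ` are inverse.
      ; nonzero-sound = λ (a , e) a≢0 eq → nonzero-sound a a≢0 (begin
          ⟦ a ⟧                       ≈⟨ *-identityʳ _ ⟨
          ⟦ a ⟧ * 1#                  ≈⟨ *-congˡ (d^δ^ 0 e) ⟨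
          ⟦ a ⟧ * (⟦ d^ e ⟧ * δ^ e)
            ≈⟨ solve 3 (λ a b c → a :* (b :* c) := (a :* c) :* b) refl _ _ _ ⟩
          value (a , e) * ⟦ d^ e ⟧    ≈⟨ *-congʳ eq ⟩
          0# * ⟦ d^ e ⟧               ≈⟨ zeroˡ _ ⟩
          0#                          ∎)
      }

    generator : Coded subring δ
    generator = (numeral 1 , 1) codes trans (*-cong ⟦d^0⟧ (*-identityʳ δ)) (*-identityˡ δ)

  -- A[x] with x² = d, with codes (a , b) for a + b x.  A vanishing element
  -- has vanishing norm a² - d b², which lies in A.
  module Adjoin (A : ComputableSubring) (d : ComputableSubring.Code A) (x : Carrier)
    (x²≈d : x * x ≈ ComputableSubring.⟦_⟧ A d) where

    open ComputableSubring A

    value : Code × Code → Carrier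
    value (a , b) = ⟦ a ⟧ + ⟦ b ⟧ * x

    mul : Op₂ (Code × Code)
    mul (a , b) (a′ , b′) = a ⊛ a′ ⊕ b ⊛ b′ ⊛ d , a ⊛ b′ ⊕ b ⊛ a′

    norm : Code × Code → Code
    norm (a , b) = a ⊛ a ⊕ ⊝ (b ⊛ b ⊛ d)

    ⊛-d : ∀ b b′ → ⟦ b ⊛ b′ ⊛ d ⟧ ≈ ⟦ b ⟧ * x * (⟦ b′ ⟧ * x)
    ⊛-d b b′ = begin
      ⟦ b ⊛ b′ ⊛ d ⟧                 ≈⟨ ⊛-≈ _ d ⟩
      ⟦ b ⊛ b′ ⟧ * ⟦ d ⟧             ≈⟨ *-cong (⊛-≈ b b′) (sym x²≈d) ⟩
      ⟦ b ⟧ * ⟦ b′ ⟧ * (x * x)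
        ≈⟨ solve 3 (λ b c x → (b :* c) :* (x :* x) := (b :* x) :* (c :* x)) refl _ _ _ ⟩
      ⟦ b ⟧ * x * (⟦ b′ ⟧ * x)       ∎

    mul-≈ : ∀ y z → value (mul y z) ≈ value y * value z
    mul-≈ (a , b) (a′ , b′) = begin
      ⟦ a ⊛ a′ ⊕ b ⊛ b′ ⊛ d ⟧ + ⟦ a ⊛ b′ ⊕ b ⊛ a′ ⟧ * x
        ≈⟨ +-cong (trans (⊕-≈ _ _) (+-cong (⊛-≈ a a′) (⊛-d b b′)))
                  (*-congʳ (trans (⊕-≈ _ _) (+-cong (⊛-≈ a b′) (⊛-≈ b a′)))) ⟩
      (⟦ a ⟧ * ⟦ a′ ⟧ + ⟦ b ⟧ * x * (⟦ b′ ⟧ * x)) + (⟦ a ⟧ * ⟦ b′ ⟧ + ⟦ b ⟧ * ⟦ a′ ⟧) * x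
        ≈⟨ solve 5 (λ a b c e x →
             (a :* c :+ b :* x :* (e :* x)) :+ (a :* e :+ b :* c) :* x
               := (a :+ b :* x) :* (c :+ e :* x)) refl _ _ _ _ _ ⟩
      value (a , b) * value (a′ , b′) ∎

    -- Vanishing means a = -bx, and squaring gives a² = b²x² = d b².
    norm-≈0 : ∀ y → value y ≈ 0# → ⟦ norm y ⟧ ≈ 0#
    norm-≈0 (a , b) eq = begin
      ⟦ a ⊛ a ⊕ ⊝ (b ⊛ b ⊛ d) ⟧
        ≈⟨ trans (⊕-≈ _ _) (+-cong (⊛-≈ a a) (trans (⊝-≈ _) (-‿cong (⊛-d b b)))) ⟩
      ⟦ a ⟧ * ⟦ a ⟧ - bx * bx     ≈⟨ +-congʳ (*-cong a≈-bx a≈-bx) ⟩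
      - bx * - bx - bx * bx       ≈⟨ +-congʳ (-*-≈ bx bx) ⟩
      bx * bx - bx * bx           ≈⟨ -‿inverseʳ _ ⟩
      0#                          ∎
      where
      bx = ⟦ b ⟧ * x
      a≈-bx : ⟦ a ⟧ ≈ - bx
      a≈-bx = +-inverseˡ-unique _ _ eq

    subring : ComputableSubring
    subring = record
      { Code = Code × Code ; ⟦_⟧ = value ; numeral = λ n → numeral n , numeral 0
      ; _⊕_ = λ (a , b) (a′ , b′) → a ⊕ a′ , b ⊕ b′ ; _⊛_ = mul ; ⊝_ = λ (a , b) → ⊝ a , ⊝ b
      -- The norm is tested in `A`, so in a tower of adjunctions the test descends norm by norm to
      -- the bottom ring.
      ; zero? = λ (a , b) → zero? a ∧ zero? b ; nonzero? = nonzero? ∘ norm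
      ; numeral-≈ = λ n → trans
          (+-cong (numeral-≈ n) (trans (*-congʳ (numeral-≈ 0)) (zeroˡ x))) (+-identityʳ _)
      ; ⊕-≈ = λ (a , b) (a′ , b′) → trans (+-cong (⊕-≈ a a′) (*-congʳ (⊕-≈ b b′)))
          (solve 5 (λ a b c e x → (a :+ c) :+ (b :+ e) :* x := (a :+ b :* x) :+ (c :+ e :* x)) refl _ _ _ _ _)
      ; ⊛-≈ = mul-≈
      ; ⊝-≈ = λ (a , b) → trans
          (+-cong (⊝-≈ a) (trans (*-congʳ (⊝-≈ b)) (sym (-‿distribˡ-* _ _)))) (-‿+-comm _ _)
      ; zero-sound = λ (a , b) ab≡0 → let a≡0 , b≡0 = Equivalence.to (T-∧ {zero? a}) ab≡0 in
          trans (+-cong (zero-sound a a≡0) (trans (*-congʳ (zero-sound b b≡0)) (zeroˡ x)))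
            (+-identityʳ _)
      ; nonzero-sound = λ y n eq → nonzero-sound (norm y) n (norm-≈0 y eq)
      }

    lift : ∀ {y} → Coded A y → Coded subring y
    lift (a codes p) = (a , numeral 0) codes
      trans (+-cong p (trans (*-congʳ (numeral-≈ 0)) (zeroˡ x))) (+-identityʳ _)

    generator : Coded subring x
    generator = (numeral 0 , numeral 1) codes
      trans (+-cong (numeral-≈ 0) (trans (*-congʳ (trans (numeral-≈ 1) ⌜1⌝≈1)) (*-identityˡ x)))
        (+-identityˡ x)

-- Inner products and faithfulness.

module Orthogonality {ℓ ℓ₁ ℓ₂} (R : RealNumbers ℓ ℓ₁ ℓ₂) where

  open RealNumbers R
  open RealArithmetic R
  open Division R
  open Complex R
  open Realification R
  open import Algebra.Properties.Ring ring using (x∙y⁻¹≈ε⇒x≈y)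
  open OrthogonalRepresentation rawRing (λ x → x)
  open CommutativeRing commutativeRing using (semiring; commutativeSemiring)
  open import Algebra.Properties.Semiring.Sum semiring using (sum-cong-≋; *-distribˡ-sum; *-distribʳ-sum)
  open import Algebra.Solver.Ring.NaturalCoefficients.Default commutativeSemiring
    using (solve; _:*_; _:=_)
  open import Relation.Binary.Reasoning.Setoid setoid

  inner-scale : ∀ {d} (x y : Vector Carrier d) α β →
    inner (λ k → x k * α) (λ k → y k * β) ≈ inner x y * (α * β)
  inner-scale x y α β = trans
    (sum-cong-≋ {x = λ k → x k * α * (y k * β)} {y = λ k → x k * y k * (α * β)} λ k →
      solve 4 (λ x y a b → (x :* a) :* (y :* b) := (x :* y) :* (a :* b)) refl (x k) (y k) α β)
    (sym (*-distribʳ-sum (α * β) (λ k → x k * y k)))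

  inner-multiple : ∀ {d} (z x y : Vector Carrier d) α →
    (∀ k → y k ≈ α * x k) → inner z y ≈ α * inner z x
  inner-multiple z x y α y≈αx = trans
    (sum-cong-≋ {x = λ k → z k * y k} {y = λ k → α * (z k * x k)} λ k → trans (*-congˡ (y≈αx k))
      (solve 3 (λ z x a → z :* (a :* x) := a :* (z :* x)) refl (z k) (x k) α))
    (sym (*-distribˡ-sum α (λ k → z k * x k)))

  cancel : ∀ {x y z} → y * z ≈ 1# → x * y ≈ 0# → x ≈ 0#
  cancel {x} {y} {z} yz≈1 xy≈0 = begin
    x             ≈⟨ *-identityʳ x ⟨
    x * 1#        ≈⟨ *-congˡ yz≈1 ⟨
    x * (y * z)   ≈⟨ *-assoc x y z ⟨
    x * y * z     ≈⟨ *-congʳ xy≈0 ⟩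
    0# * z        ≈⟨ zeroˡ z ⟩
    0#            ∎

  module _ {H : ThreeUniformHypergraph} (L : Listing H) {d : ℕ} where
    open ThreeUniformHypergraph H
    open Listing L

    -- Anisotropy serves twice: it excludes zero vectors, and it settles the case where the
    -- separating vertex is `w` itself.
    faithful : (x : Vertex → Vector Carrier d) → 3 ℕ.≤ d → Separating →
      (∀ u → ¬ inner (x u) (x u) ≈ 0#) →
      (∀ {u w} → u ≢ w → inner (x u) (x w) ≈ 0# ⇔ InCommonHyperedge u w) →
      IsFaithful H d x
    faithful x 3≤d separating anisotropic orthogonal = record
      { 3≤d = 3≤d
      -- A zero vector is 0 times itself, hence orthogonal to itself.
      ; nonzero = λ u x≈0 → anisotropic u (trans (inner-multiple (x u) (x u) (x u) 0#
          λ k → trans (x≈0 k) (sym (zeroˡ _))) (zeroˡ _))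
      ; distinct = distinct
      ; orthogonal = orthogonal
      }
      where
      distinct : ∀ {u w} → u ≢ w → ¬ (Ray (x u) ≐ Ray (x w))
      distinct {u} {w} u≢w (_ , w⊆u) with separate separating u≢w
      ... | z , z~u , z≢u , alternative = contradict alternative
        where
        -- `x w` lies in its own ray with coefficient 1, so it is a multiple of `x u` and inherits
        -- the orthogonality to `x z`.
        x_w∈Ray : Ray (x u) (x w)
        x_w∈Ray = w⊆u (1# , λ k → sym (*-identityˡ _))
        z⊥w : inner (x z) (x w) ≈ 0#
        z⊥w = trans (inner-multiple (x z) (x u) (x w) (proj₁ x_w∈Ray) (proj₂ x_w∈Ray))
          (trans (*-congˡ (Equivalence.from (orthogonal z≢u) z~u)) (zeroʳ _))
        z≢w : z ≢ w
        z≢w ≡.refl = anisotropic w z⊥w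
        contradict : ¬ (z ≡ w ⊎ ¬ InCommonHyperedge z w)
        contradict (inj₁ z≡w) = z≢w z≡w
        contradict (inj₂ z≁w) = z≁w (Equivalence.to (orthogonal z≢w) z⊥w)

  -- Codes for real and complex expressions.

  module Coding (A : ComputableSubring) where
    open ComputableSubring A

    infix  8 -̂_ -̂ᶜ_
    infixl 7 _*̂_ _*̂ᶜ_
    infixl 6 _+̂_ _-̂_ _-̂ᶜ_
    infix  5 _+̂i_

    ⌜_⌝̂ : ∀ n → Coded A ⌜ n ⌝
    ⌜ n ⌝̂ = numeral n codes numeral-≈ n

    0̂ : Coded A 0#
    0̂ = ⌜ 0 ⌝̂

    1̂ : Coded A 1#
    1̂ = numeral 1 codes trans (numeral-≈ 1) ⌜1⌝≈1

    _+̂_ : ∀ {x y} → Coded A x → Coded A y → Coded A (x + y)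
    (a codes p) +̂ (b codes q) = a ⊕ b codes trans (⊕-≈ a b) (+-cong p q)

    _*̂_ : ∀ {x y} → Coded A x → Coded A y → Coded A (x * y)
    (a codes p) *̂ (b codes q) = a ⊛ b codes trans (⊛-≈ a b) (*-cong p q)

    -̂_ : ∀ {x} → Coded A x → Coded A (- x)
    -̂ (a codes p) = ⊝ a codes trans (⊝-≈ a) (-‿cong p)

    _-̂_ : ∀ {x y} → Coded A x → Coded A y → Coded A (x - y)
    x̂ -̂ ŷ = x̂ +̂ -̂ ŷ

    equal? : ∀ {x y} → Coded A x → Coded A y → Bool
    equal? x̂ ŷ = zero? (code (x̂ -̂ ŷ))

    equal : ∀ {x y} (x̂ : Coded A x) (ŷ : Coded A y) → T (equal? x̂ ŷ) → x ≈ y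
    equal x̂ ŷ ok = x∙y⁻¹≈ε⇒x≈y _ _ (trans (sym (sound (x̂ -̂ ŷ))) (zero-sound _ ok))

    Codedᶜ : ℂ → Set ℓ₁
    Codedᶜ z = Coded A (re z) × Coded A (im z)

    _+̂i_ : ∀ {x y} → Coded A x → Coded A y → Codedᶜ (x +i y)
    _+̂i_ = _,_

    fromReal̂ : ∀ {x} → Coded A x → Codedᶜ (fromReal x)
    fromReal̂ x̂ = x̂ +̂i 0̂

    0̂ᶜ : Codedᶜ 0ᶜ
    0̂ᶜ = fromReal̂ 0̂

    1̂ᶜ : Codedᶜ 1ᶜ
    1̂ᶜ = fromReal̂ 1̂

    î : Codedᶜ 𝐢
    î = 0̂ +̂i 1̂

    _-̂ᶜ_ : ∀ {z w} → Codedᶜ z → Codedᶜ w → Codedᶜ (z -ᶜ w)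
    (x̂ , ŷ) -̂ᶜ (x̂′ , ŷ′) = x̂ -̂ x̂′ +̂i ŷ -̂ ŷ′

    _*̂ᶜ_ : ∀ {z w} → Codedᶜ z → Codedᶜ w → Codedᶜ (z *ᶜ w)
    (x̂ , ŷ) *̂ᶜ (x̂′ , ŷ′) = x̂ *̂ x̂′ -̂ ŷ *̂ ŷ′ +̂i x̂ *̂ ŷ′ +̂ ŷ *̂ x̂′

    -̂ᶜ_ : ∀ {z} → Codedᶜ z → Codedᶜ (-ᶜ z)
    -̂ᶜ (x̂ , ŷ) = -̂ x̂ +̂i -̂ ŷ

    conĵ : ∀ {z} → Codedᶜ z → Codedᶜ (conj z)
    conĵ (x̂ , ŷ) = x̂ +̂i -̂ ŷ

    Codedⱽ : ∀ {d} → Vector ℂ d → Set ℓ₁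
    Codedⱽ z = ∀ k → Codedᶜ (z k)

    ⟨_,_,_⟩̂ : ∀ {x y z} → Codedᶜ x → Codedᶜ y → Codedᶜ z → Codedⱽ ⟨ x , y , z ⟩
    ⟨ x̂ , ŷ , ẑ ⟩̂ 0F = x̂
    ⟨ x̂ , ŷ , ẑ ⟩̂ 1F = ŷ
    ⟨ x̂ , ŷ , ẑ ⟩̂ 2F = ẑ

    _⨯̂_ : ∀ {u w} → Codedⱽ u → Codedⱽ w → Codedⱽ (u ⨯ w)
    û ⨯̂ ŵ = ⟨ û 1F *̂ᶜ ŵ 2F -̂ᶜ û 2F *̂ᶜ ŵ 1F
            , û 2F *̂ᶜ ŵ 0F -̂ᶜ û 0F *̂ᶜ ŵ 2F
            , û 0F *̂ᶜ ŵ 1F -̂ᶜ û 1F *̂ᶜ ŵ 0F ⟩̂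

    -- For n dividing D = 1/δ, the inverse of n is coded as (D/n) δ.
    module Quotient (D : ℕ) {δ : Carrier} (δ̂ : Coded A δ) where
      infixl 7 _/̂_

      _/̂_ : ∀ {x} → Coded A x → (n : ℕ) .{{_ : NonZero n}} →
        -- Evaluated at each use; it certifies that the coded factor times `n` is 1, so that this
        -- factor agrees with the inverse used by `_/_`.
        {T (equal? (⌜ D ℕ./ n ⌝̂ *̂ δ̂ *̂ ⌜ n ⌝̂) 1̂)} → Coded A (x / n)
      _/̂_ x̂ n@(ℕ.suc m) {ok} = code (x̂ *̂ b̂) codes trans (sound (x̂ *̂ b̂)) (*-congˡ b≈1/n)
        where
        b = ⌜ D ℕ./ n ⌝ * δ
        b̂ = ⌜ D ℕ./ n ⌝̂ *̂ δ̂
        n⁻¹ = inv ⌜ n ⌝ (#-sym (<⇒# (0<suc m)))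
        b≈1/n : b ≈ n⁻¹
        b≈1/n = begin
          b                     ≈⟨ *-identityʳ _ ⟨
          b * 1#                ≈⟨ *-congˡ (*-inv ⌜ n ⌝ _) ⟨
          b * (⌜ n ⌝ * n⁻¹)     ≈⟨ *-assoc _ _ _ ⟨
          b * ⌜ n ⌝ * n⁻¹       ≈⟨ *-congʳ (equal (b̂ *̂ ⌜ n ⌝̂) 1̂ ok) ⟩
          1# * n⁻¹              ≈⟨ *-identityˡ _ ⟩
          n⁻¹                   ∎

    dot : ∀ {d} → Vec Code d → Vec Code d → Code
    dot []       []       = numeral 0
    dot (a ∷ as) (b ∷ bs) = a ⊛ b ⊕ dot as bs

    dot-≈ : ∀ {d} (as bs : Vec Code d) (x y : Vector Carrier d) →
      (∀ k → ⟦ Vec.lookup as k ⟧ ≈ x k) → (∀ k → ⟦ Vec.lookup bs k ⟧ ≈ y k) →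
      ⟦ dot as bs ⟧ ≈ inner x y
    dot-≈ []       []       x y p q = numeral-≈ 0
    dot-≈ (a ∷ as) (b ∷ bs) x y p q = trans (⊕-≈ _ _) (+-cong
      (trans (⊛-≈ a b) (*-cong (p Fin.zero) (q Fin.zero)))
      (dot-≈ as bs (x ∘ Fin.suc) (y ∘ Fin.suc) (p ∘ Fin.suc) (q ∘ Fin.suc)))

    -- Testing the Gram matrix by computation.

    module _ {H : ThreeUniformHypergraph} (L : Listing H) {d : ℕ} where
      open ThreeUniformHypergraph H
      open Listing L

      -- Equality is consulted before adjacency because `_~_` relates every vertex on an edge to
      -- itself, while the diagonal must be nonzero.
      verdict : ∀ {p q} {P : Set p} {Q : Set q} → Dec P → Dec Q → Code → Bool
      verdict (yes _) _       g = nonzero? g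
      verdict (no _)  (yes _) g = zero? g
      verdict (no _)  (no _)  g = nonzero? g

      Consistent : Vec (Vec Code d) order → Set
      Consistent table = ∀ i j →
        T (verdict (i ≟ᶠ j) (i ~? j) (dot (Vec.lookup table i) (Vec.lookup table j)))

      consistent? : ∀ table → Dec (Consistent table)
      consistent? table = allᶠ? λ i → allᶠ? λ j → T? _

      module _ {x : Vertex → Vector Carrier d} (x̂ : ∀ u k → Coded A (x u k)) where

        -- Storing the codes as data, not as a function, lets all the inner products share their
        -- evaluation.
        table : Vec (Vec Code d) order
        table = Vec.tabulate λ i → Vec.tabulate λ k → code (x̂ (vertex i) k)

        table-≈ : ∀ i k → ⟦ Vec.lookup (Vec.lookup table i) k ⟧ ≈ x (vertex i) k
        table-≈ i k = trans (reflexive (≡.cong ⟦_⟧ (≡.trans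
          (≡.cong (λ row → Vec.lookup row k) (lookup∘tabulate _ i)) (lookup∘tabulate _ k))))
          (sound (x̂ (vertex i) k))

        -- The code is bound existentially, so that a later `with` on the two decisions refines the
        -- verdict and leaves the code opaque.
        gram : True (consistent? table) → ∀ u w → ∃ λ g →
          ⟦ g ⟧ ≈ inner (x u) (x w) × T (verdict (index u ≟ᶠ index w) (index u ~? index w) g)
        gram ok u w = g
          , ≡.subst₂ (λ u w → ⟦ g ⟧ ≈ inner (x u) (x w)) (vertex-index u) (vertex-index w)
              (dot-≈ (row u) (row w) _ _ (table-≈ (index u)) (table-≈ (index w)))
          , toWitness ok (index u) (index w)
          where
          row : Vertex → Vec Code d
          row u = Vec.lookup table (index u)
          g = dot (row u) (row w)

        -- The factors `α` carry no codes, so the test runs on the unscaled vectors. Being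
        -- invertible, the factors do not change which inner products vanish.
        coded-faithful : 3 ℕ.≤ d → Separating → True (consistent? table) →
          (α β : Vertex → Carrier) → (∀ u → α u * β u ≈ 1#) →
          IsFaithful H d (λ u k → x u k * α u)
        coded-faithful 3≤d separating ok α β αβ≈1 =
          faithful L _ 3≤d separating
            (λ u → anisotropic u ∘ unscale u u)
            (λ {u} {w} u≢w → mk⇔
              (orthogonal⇒ u≢w ∘ unscale u w)
              (λ u~w → trans (inner-scale (x u) (x w) (α u) (α w))
                (trans (*-congʳ (orthogonal⇐ u≢w u~w)) (zeroˡ _))))
          where
          unscale : ∀ u w → inner (λ k → x u k * α u) (λ k → x w k * α w) ≈ 0# →
            inner (x u) (x w) ≈ 0#
          unscale u w eq = cancel {z = β u * β w}
            (trans (solve 4 (λ a b c e → (a :* b) :* (c :* e) := (a :* c) :* (b :* e)) refl (α u) (α w) (β u) (β w))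
              (trans (*-cong (αβ≈1 u) (αβ≈1 w)) (*-identityˡ 1#)))
            (trans (sym (inner-scale (x u) (x w) (α u) (α w))) eq)

          anisotropic : ∀ u → ¬ inner (x u) (x u) ≈ 0#
          anisotropic u eq with gram ok u u
          ... | g , g≈ , t with index u ≟ᶠ index u
          ...   | yes _   = nonzero-sound g t (trans g≈ eq)
          ...   | no  u≢u = u≢u ≡.refl

          orthogonal⇒ : ∀ {u w} → u ≢ w → inner (x u) (x w) ≈ 0# → InCommonHyperedge u w
          orthogonal⇒ {u} {w} u≢w eq with gram ok u w
          ... | g , g≈ , t with index u ≟ᶠ index w | index u ~? index w
          ...   | yes u≡w | _       = contradiction (index-injective u≡w) u≢w
          ...   | no _    | yes u~w = Equivalence.to ~⇔ u~w
          ...   | no _    | no _    = contradiction (trans g≈ eq) (nonzero-sound g t)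

          orthogonal⇐ : ∀ {u w} → u ≢ w → InCommonHyperedge u w → inner (x u) (x w) ≈ 0#
          orthogonal⇐ {u} {w} u≢w u~w with gram ok u w
          ... | g , g≈ , t with index u ≟ᶠ index w | index u ~? index w
          ...   | yes u≡w | _      = contradiction (index-injective u≡w) u≢w
          ...   | no _    | yes _  = trans (sym g≈) (zero-sound g t)
          ...   | no _    | no u≁w = contradiction (Equivalence.from ~⇔ u~w) u≁w

    -- Coded realification of complex vectors.

    re-part im-part : ℕ → Vector ℂ 3 → Vector Carrier 3
    re-part t z k = re (z k) - ⌜ t ⌝ * im (z k)
    im-part t z k = im (z k) + ⌜ t ⌝ * re (z k)

    -- This is `Φ` without its normalising factor, whose square root need not lie in the subring.
    unscaled : ℕ → Vector ℂ 3 → Vector Carrier 6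
    unscaled t z = re-part t z Functional.++ im-part t z

    unscaled̂ : ∀ t {z} → Codedⱽ z → ∀ k → Coded A (unscaled t z k)
    -- Concatenation of functional vectors is a case split on `splitAt 3 k`, which this motive
    -- follows.
    unscaled̂ t {z} ẑ k = Sum.[_,_] {C = λ i → Coded A (Sum.[ re-part t z , im-part t z ] i)}
      (λ k → let x̂ , ŷ = ẑ k in x̂ -̂ ⌜ t ⌝̂ *̂ ŷ)
      (λ k → let x̂ , ŷ = ẑ k in ŷ +̂ ⌜ t ⌝̂ *̂ x̂)
      (splitAt 3 k)

    module _ {H : ThreeUniformHypergraph} (L : Listing H)
      (t : ThreeUniformHypergraph.Vertex H → ℕ)
      {z : ThreeUniformHypergraph.Vertex H → Vector ℂ 3} (ẑ : ∀ u → Codedⱽ (z u)) where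

      open ThreeUniformHypergraph H
      open Listing L

      Φ-table : Vec (Vec Code 6) order
      Φ-table = table L (λ u → unscaled̂ (t u) (ẑ u))

      -- `Φ` unfolds to `unscaled` times a factor depending only on the vertex, with inverse
      -- √(1+t²).
      Φ-faithful : Separating → True (consistent? L Φ-table) → IsFaithful H 6 (λ u → Φ ⌜ t u ⌝ (z u))
      Φ-faithful separating ok =
        coded-faithful L (λ u → unscaled̂ (t u) (ẑ u)) (ℕ.s≤s (ℕ.s≤s (ℕ.s≤s ℕ.z≤n))) separating ok
          (λ u → inv (√ (1# + ⌜ t u ⌝ * ⌜ t u ⌝)) (√[1+t²]#0 ⌜ t u ⌝))
          (λ u → √ (1# + ⌜ t u ⌝ * ⌜ t u ⌝))
          (λ u → trans (*-comm _ _) (*-inv _ (√[1+t²]#0 ⌜ t u ⌝)))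

-- The representation with 20 vertices.

module Representation₂₀ {ℓ ℓ₁ ℓ₂} (R : RealNumbers ℓ ℓ₁ ℓ₂) where

  open RealNumbers R
  open Division R
  open RealArithmetic R
  open Orthogonality R
  open Vectors₂₀ R

  -- 130 is the least common multiple of 13, 26 and 65, the denominators in `η`, `C` and `ζ`.
  δ : Carrier
  δ = inv ⌜ 130 ⌝ (#-sym (<⇒# (0<suc 129)))

  module ℤ[δ] = Localise integers (+ 130) δ (*-inv ⌜ 130 ⌝ _)
  module Base = Coding ℤ[δ].subring

  module ℚ[√69] where
    open Adjoin ℤ[δ].subring (code Base.⌜ 69 ⌝̂) (√ ⌜ 69 ⌝)
      (trans (√⌜⌝-square 68) (sym (sound Base.⌜ 69 ⌝̂))) public
    open Coding subring public
    open Quotient 130 (lift ℤ[δ].generator)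

    -- Used twice: to show that `C` is positive, so that `√-square` applies to `s`, and as the
    -- radicand when `s` is adjoined.
    Ĉ : Coded subring C
    Ĉ = (⌜ 49 ⌝̂ -̂ ⌜ 5 ⌝̂ *̂ generator) /̂ 26

    N̂ : Coded subring N
    N̂ = 1̂ +̂ Ĉ

    -- 26 = C (49 + 5√69)
    0<C : 0# < C
    0<C = positive-factor
      (+-pos (0<suc 48) (*-pos (0<suc 4) (√-pos (0<suc 68))))
      (<.<-respʳ-≈ (equal ⌜ 26 ⌝̂ (Ĉ *̂ (⌜ 49 ⌝̂ +̂ ⌜ 5 ⌝̂ *̂ generator)) _) (0<suc 25))

    0<N : 0# < N
    0<N = +-pos 0<1 0<C

  module ℚ[√69,s] where
    open ℚ[√69] using (Ĉ; 0<C)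
    open Adjoin ℚ[√69].subring (code Ĉ) s (trans (√-square (<.asym 0<C)) (sym (sound Ĉ))) public

  -- `r` is adjoined on top of `s`, so its radicand is lifted to that level.
  N̂ : Coded ℚ[√69,s].subring N
  N̂ = ℚ[√69,s].lift ℚ[√69].N̂

  open Adjoin ℚ[√69,s].subring (code N̂) r (trans (√-square (<.asym ℚ[√69].0<N)) (sym (sound N̂)))
  open Coding subring
  open Quotient 130 (lift (ℚ[√69,s].lift (ℚ[√69].lift ℤ[δ].generator)))

  √69̂ : Coded subring (√ ⌜ 69 ⌝)
  √69̂ = lift (ℚ[√69,s].lift ℚ[√69].generator)

  η̂ : Codedᶜ η
  η̂ = ⌜ 5 ⌝̂ /̂ 13 +̂i ⌜ 12 ⌝̂ /̂ 13

  ζ̂ : Codedᶜ ζ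
  ζ̂ = (⌜ 14 ⌝̂ +̂ ⌜ 6 ⌝̂ *̂ √69̂) /̂ 65 +̂i (⌜ 4 ⌝̂ *̂ √69̂ -̂ ⌜ 21 ⌝̂) /̂ 65

  ŝ : Codedᶜ sᶜ
  ŝ = fromReal̂ (lift ℚ[√69,s].generator)

  r̂ : Codedᶜ rᶜ
  r̂ = fromReal̂ generator

  μ̂ : ∀ j → Codedᶜ (μ j)
  μ̂ 0F = -̂ᶜ 1̂ᶜ
  μ̂ 1F = η̂
  μ̂ 2F = 1̂ᶜ
  μ̂ 3F = -̂ᶜ η̂
  μ̂ 4F = -̂ᶜ 1̂ᶜ
  μ̂ 5F = η̂
  μ̂ 6F = 1̂ᶜ
  μ̂ 7F = -̂ᶜ η̂

  τ̂ : ∀ j → Codedᶜ (τ j)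
  τ̂ 0F = 1̂ᶜ
  τ̂ 1F = ζ̂
  τ̂ 2F = -̂ᶜ î
  τ̂ 3F = -̂ᶜ î *̂ᶜ ζ̂
  τ̂ 4F = -̂ᶜ 1̂ᶜ
  τ̂ 5F = -̂ᶜ ζ̂
  τ̂ 6F = î
  τ̂ 7F = î *̂ᶜ ζ̂

  ψv̂ : ∀ j → Codedⱽ (ψv j)
  ψv̂ j = ⟨ 1̂ᶜ , ŝ *̂ᶜ μ̂ j , r̂ *̂ᶜ τ̂ j ⟩̂

  ψ̂ : ∀ u → Codedⱽ (ψ u)
  ψ̂ (v j)  = ψv̂ j
  ψ̂ (v⁺ j) = λ k → conĵ ((ψv̂ j ⨯̂ ψv̂ (next j)) k)
  ψ̂ a₁     = ⟨ ŝ , 1̂ᶜ , 0̂ᶜ ⟩̂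
  ψ̂ a₂     = ⟨ ŝ , -̂ᶜ 1̂ᶜ , 0̂ᶜ ⟩̂
  ψ̂ b₁     = ⟨ ŝ , η̂ , 0̂ᶜ ⟩̂
  ψ̂ b₂     = ⟨ ŝ , -̂ᶜ η̂ , 0̂ᶜ ⟩̂

  -- The final `_` stands for the evaluated test of all 400 inner products.
  faithful₂₀ : IsFaithfulOrthogonalRepresentation R H₂₀ 6 R₂₀
  faithful₂₀ = Φ-faithful listing₂₀ t ψ̂ separating₂₀ _

-- The representation with 21 vertices.

module Representation₂₁ {ℓ ℓ₁ ℓ₂} (R : RealNumbers ℓ ℓ₁ ℓ₂) where

  open RealNumbers R
  open Division R
  open RealArithmetic R
  open Orthogonality R
  open Vectors₂₁ R

  δ : Carrier
  δ = inv ⌜ 4 ⌝ (#-sym (<⇒# (0<suc 3)))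

  module ℤ[δ] = Localise integers (+ 4) δ (*-inv ⌜ 4 ⌝ _)
  module Base = Coding ℤ[δ].subring

  -- The coordinates are built from 1, √2, `p` and `q`, so adjoining √2 and then √14 reaches all of
  -- them.
  module ℚ[√2] = Adjoin ℤ[δ].subring (code Base.⌜ 2 ⌝̂) √2
    (trans (√⌜⌝-square 1) (sym (sound Base.⌜ 2 ⌝̂)))

  1̂4̂ : Coded ℚ[√2].subring ⌜ 14 ⌝
  1̂4̂ = ℚ[√2].lift Base.⌜ 14 ⌝̂

  open Adjoin ℚ[√2].subring (code 1̂4̂) (√ ⌜ 14 ⌝)
    (trans (√⌜⌝-square 13) (sym (sound 1̂4̂)))
  open Coding subring
  open Quotient 4 (lift (ℚ[√2].lift ℤ[δ].generator))

  √2̂ : Coded subring √2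
  √2̂ = lift ℚ[√2].generator

  p̂ : Coded subring p
  p̂ = (generator +̂ √2̂) /̂ 4

  q̂ : Coded subring q
  q̂ = (generator -̂ √2̂) /̂ 4

  ψv̂ : ∀ j → Codedⱽ (ψv j)
  ψv̂ 0F = ⟨ 1̂ᶜ , -̂ᶜ 1̂ᶜ , √2̂ +̂i 0̂      ⟩̂
  ψv̂ 1F = ⟨ 1̂ᶜ , î      , p̂ +̂i q̂       ⟩̂
  ψv̂ 2F = ⟨ 1̂ᶜ , 1̂ᶜ     , 0̂ +̂i -̂ √2̂    ⟩̂
  ψv̂ 3F = ⟨ 1̂ᶜ , -̂ᶜ î   , q̂ +̂i -̂ p̂     ⟩̂
  ψv̂ 4F = ⟨ 1̂ᶜ , -̂ᶜ 1̂ᶜ , -̂ √2̂ +̂i 0̂    ⟩̂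
  ψv̂ 5F = ⟨ 1̂ᶜ , î      , -̂ p̂ +̂i -̂ q̂  ⟩̂
  ψv̂ 6F = ⟨ 1̂ᶜ , 1̂ᶜ     , 0̂ +̂i √2̂      ⟩̂
  ψv̂ 7F = ⟨ 1̂ᶜ , -̂ᶜ î   , -̂ q̂ +̂i p̂    ⟩̂

  ψv⁺̂ : ∀ j → Codedⱽ (ψv⁺ j)
  ψv⁺̂ 0F = ⟨ -̂ p̂ +̂i q̂ +̂ √2̂        , √2̂ -̂ p̂ +̂i q̂        , 1̂ +̂i -̂ 1̂    ⟩̂
  ψv⁺̂ 1F = ⟨ √2̂ -̂ p̂ +̂i q̂          , p̂ +̂i -̂ (q̂ +̂ √2̂)    , 1̂ +̂i 1̂      ⟩̂
  ψv⁺̂ 2F = ⟨ q̂ +̂ √2̂ +̂i p̂          , -̂ q̂ +̂i √2̂ -̂ p̂      , -̂ 1̂ +̂i 1̂    ⟩̂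
  ψv⁺̂ 3F = ⟨ q̂ +̂i p̂ -̂ √2̂          , q̂ +̂ √2̂ +̂i p̂        , -̂ 1̂ +̂i -̂ 1̂ ⟩̂
  ψv⁺̂ 4F = ⟨ p̂ +̂i -̂ (q̂ +̂ √2̂)      , -̂ √2̂ +̂ p̂ +̂i -̂ q̂   , 1̂ +̂i -̂ 1̂    ⟩̂
  ψv⁺̂ 5F = ⟨ -̂ √2̂ +̂ p̂ +̂i -̂ q̂     , -̂ p̂ +̂i q̂ +̂ √2̂      , 1̂ +̂i 1̂      ⟩̂
  ψv⁺̂ 6F = ⟨ -̂ q̂ -̂ √2̂ +̂i -̂ p̂     , q̂ +̂i -̂ (√2̂ -̂ p̂)    , -̂ 1̂ +̂i 1̂    ⟩̂
  ψv⁺̂ 7F = ⟨ -̂ q̂ +̂i -̂ (p̂ -̂ √2̂)   , -̂ q̂ -̂ √2̂ +̂i -̂ p̂   , -̂ 1̂ +̂i -̂ 1̂ ⟩̂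

  ψ̂ : ∀ u → Codedⱽ (ψ u)
  ψ̂ c            = ⟨ 0̂ᶜ , 0̂ᶜ , 1̂ᶜ ⟩̂
  ψ̂ (old a₁)     = ⟨ 1̂ᶜ , 1̂ᶜ , 0̂ᶜ ⟩̂
  ψ̂ (old a₂)     = ⟨ 1̂ᶜ , -̂ᶜ 1̂ᶜ , 0̂ᶜ ⟩̂
  ψ̂ (old b₁)     = ⟨ 1̂ᶜ , î , 0̂ᶜ ⟩̂
  ψ̂ (old b₂)     = ⟨ 1̂ᶜ , -̂ᶜ î , 0̂ᶜ ⟩̂
  ψ̂ (old (v j))  = ψv̂ j
  ψ̂ (old (v⁺ j)) = ψv⁺̂ j

  faithful₂₁ : IsFaithfulOrthogonalRepresentation R H₂₁ 6 R₂₁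
  faithful₂₁ = Φ-faithful listing₂₁ t ψ̂ separating₂₁ _

corollary9 : ∀ {ℓ ℓ₁ ℓ₂ : Level} (R : RealNumbers ℓ ℓ₁ ℓ₂) →
    IsFaithfulOrthogonalRepresentation R H₂₀ 6 (Vectors₂₀.R₂₀ R)
    × IsFaithfulOrthogonalRepresentation R H₂₁ 6 (Vectors₂₁.R₂₁ R)
corollary9 R = Representation₂₀.faithful₂₀ R , Representation₂₁.faithful₂₁ R
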